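{- Let $\delta>k\ge 0$ be integers and let $n$ be sufficiently large (i.e. $n\ge n_0(k,\delta)$ for some $n_0$ depending only on $k$ and $\delta$). If $G$ is an $n$-vertex graph with minimum degree $\delta(G)\ge\delta$ and $$e(G)>e(H_{n,k,\delta+1}),$$ then $G$ is $k$-Hamiltonian unless $G\subseteq H_{n,k,\delta}$ or $G\subseteq L_{n,k,\delta}$.
   Context: All graphs are finite and simple; $e(G)$ is the number of edges of $G$, and $G\subseteq H$ means $G$ is (isomorphic to) a subgraph of $H$. $K_s$ is the complete graph on $s$ vertices, $I_t$ is the edgeless graph on $t$ vertices, $G\cup H$ is the disjoint union, and $G\vee H$ is the join (obtained from $G\cup H$ by adding all edges between $G$ and $H$). A graph is Hamiltonian if it has a Hamilton cycle (a cycle through all vertices). A graph $G=(V,E)$ is $k$-Hamiltonian if for all $S\subseteq V$ with $|S|\le k$, the subgraph induced by $V\setminus S$ is Hamiltonian. For integers $d>k\ge 0$ and $n$ large, define $$H_{n,k,d}:=K_d\vee(K_{n-2d+k}\cup I_{d-k}),\qquad L_{n,k,d}:=K_{k+1}\vee(K_{n-d-1}\cup K_{d-k}).$$ -}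

module Defs where

open import Data.Empty using (⊥)
open import Data.Fin using (Fin; splitAt)
open import Data.Fin.Properties using () renaming (_≟_ to _≟ᶠ_; _<?_ to _<ᶠ?_)
open import Data.Fin.Subset using (Subset; ∣_∣; ∁)
open import Data.Fin.Subset.Properties using () renaming (_∈?_ to _∈ˢ?_)
open import Data.List using (List; _∷_; _∷ʳ_; length; map; filter; lookup; allFin; cartesianProduct)
open import Data.List.Extrema.Nat using (min)
open import Data.List.Membership.Propositional using (_∈_)
open import Data.List.Relation.Unary.Linked using (Linked)
open import Data.List.Relation.Unary.Unique.Propositional using (Unique)
open import Data.Nat using (ℕ; _+_; _*_; _∸_; _≤_)
open import Data.Product using (_×_; _,_; ∃; ∃₂)
open import Data.Sum using (_⊎_; inj₁; inj₂)
open import Function using (_on_)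
open import Function.Definitions using (Injective)
open import Level using (0ℓ)
open import Relation.Binary using (Rel; Decidable; Symmetric)
open import Relation.Binary.PropositionalEquality using (_≡_; _≢_; refl; ≢-sym)
open import Relation.Nullary using (Dec; ¬_; no)
open import Relation.Nullary.Decidable using (_×-dec_; ¬?; ⊤-dec; ⊥-dec)

record Graph (n : ℕ) : Set₁ where
  field
    Adj     : Rel (Fin n) 0ℓ
    adj?    : Decidable Adj
    adj-sym : Symmetric Adj
    irrefl  : ∀ v → ¬ Adj v v

open Graph public

edges : ∀ {n} → Graph n → List (Fin n × Fin n)
edges {n} G =
  filter (λ (u , v) → (u <ᶠ? v) ×-dec adj? G u v) (cartesianProduct (allFin n) (allFin n))

e : ∀ {n} → Graph n → ℕ
e G = length (edges G)

degree : ∀ {n} → Graph n → Fin n → ℕ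
degree {n} G v = length (filter (adj? G v) (allFin n))

-- The first argument of min is the value on the empty list; as every degree is
-- below n, it does not affect the minimum when n > 0.
minDegree : ∀ {n} → Graph n → ℕ
minDegree {n} G = min n (map (degree G) (allFin n))

infix 4 _⊑_

-- G is isomorphic to a (not necessarily induced) subgraph of H.
_⊑_ : ∀ {m n} → Graph m → Graph n → Set
_⊑_ {m} {n} G H =
  ∃ λ (f : Fin m → Fin n) → Injective _≡_ _≡_ f × (∀ {u v} → Adj G u v → Adj H (f u) (f v))

K : ∀ s → Graph s
K s = record
  { Adj     = _≢_
  ; adj?    = λ u v → ¬? (u ≟ᶠ v)
  ; adj-sym = ≢-sym
  ; irrefl  = λ _ v≢v → v≢v refl
  }

I : ∀ t → Graph t
I t = record
  { Adj     = λ _ _ → ⊥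
  ; adj?    = λ _ _ → no λ ()
  ; adj-sym = λ ()
  ; irrefl  = λ _ ()
  }

-- Adjacency on a disjoint union of vertex sets, where all (C = ⊤) or none
-- (C = ⊥) of the pairs across the two sides are adjacent.
module _ {m n} (G : Graph m) (H : Graph n) {C : Set} (C? : Dec C) where

  SumAdj : Rel (Fin m ⊎ Fin n) 0ℓ
  SumAdj (inj₁ u) (inj₁ v) = Adj G u v
  SumAdj (inj₂ u) (inj₂ v) = Adj H u v
  SumAdj (inj₁ _) (inj₂ _) = C
  SumAdj (inj₂ _) (inj₁ _) = C

  sumAdj? : Decidable SumAdj
  sumAdj? (inj₁ u) (inj₁ v) = adj? G u v
  sumAdj? (inj₂ u) (inj₂ v) = adj? H u v
  sumAdj? (inj₁ _) (inj₂ _) = C?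
  sumAdj? (inj₂ _) (inj₁ _) = C?

  sumAdj-sym : Symmetric SumAdj
  sumAdj-sym {inj₁ _} {inj₁ _} p = adj-sym G p
  sumAdj-sym {inj₂ _} {inj₂ _} p = adj-sym H p
  sumAdj-sym {inj₁ _} {inj₂ _} p = p
  sumAdj-sym {inj₂ _} {inj₁ _} p = p

  sumAdj-irrefl : ∀ x → ¬ SumAdj x x
  sumAdj-irrefl (inj₁ v) = irrefl G v
  sumAdj-irrefl (inj₂ v) = irrefl H v

  sumGraph : Graph (m + n)
  sumGraph = record
    { Adj     = SumAdj on splitAt m
    ; adj?    = λ u v → sumAdj? (splitAt m u) (splitAt m v)
    ; adj-sym = λ {u} {v} → sumAdj-sym {splitAt m u} {splitAt m v}
    ; irrefl  = λ v → sumAdj-irrefl (splitAt m v)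
    }

infixr 6 _∪_ _∨_

_∪_ : ∀ {m n} → Graph m → Graph n → Graph (m + n)
G ∪ H = sumGraph G H ⊥-dec

_∨_ : ∀ {m n} → Graph m → Graph n → Graph (m + n)
G ∨ H = sumGraph G H ⊤-dec

members : ∀ {n} → Subset n → List (Fin n)
members {n} S = filter (_∈ˢ? S) (allFin n)

-- The vertices of the induced subgraph are the positions in members S.
induced : ∀ {n} → Graph n → (S : Subset n) → Graph (length (members S))
induced G S = record
  { Adj     = Adj G on lookup (members S)
  ; adj?    = λ u v → adj? G (lookup (members S) u) (lookup (members S) v)
  ; adj-sym = adj-sym G
  ; irrefl  = λ v → irrefl G (lookup (members S) v)
  }

-- The list v ∷ vs of distinct vertices, closed up by returning to v.
record IsCycle {n} (G : Graph n) (v : Fin n) (vs : List (Fin n)) : Set where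
  field
    length≥3 : 3 ≤ length (v ∷ vs)
    distinct : Unique (v ∷ vs)
    closed   : Linked (Adj G) (v ∷ (vs ∷ʳ v))

Hamiltonian : ∀ {n} → Graph n → Set
Hamiltonian G = ∃₂ λ v vs → IsCycle G v vs × (∀ u → u ∈ v ∷ vs)

_-Hamiltonian : ℕ → ∀ {n} → Graph n → Set
(k -Hamiltonian) {n} G = ∀ (S : Subset n) → ∣ S ∣ ≤ k → Hamiltonian (induced G (∁ S))

-- For k < d and 2d ≤ n + k the subtractions are exact and the graph has n vertices.
H[_,_,_] : ∀ n k d → Graph (d + (((n + k) ∸ 2 * d) + (d ∸ k)))
H[ n , k , d ] = K d ∨ (K ((n + k) ∸ 2 * d) ∪ I (d ∸ k))

-- For k < d < n the subtractions are exact and the graph has n vertices.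
L[_,_,_] : ∀ n k d → Graph ((k + 1) + ((n ∸ d ∸ 1) + (d ∸ k)))
L[ n , k , d ] = K (k + 1) ∨ (K (n ∸ d ∸ 1) ∪ K (d ∸ k))

module Submission where

import Algebra.Properties.CommutativeMonoid.Sum as FinSum
open import Data.Bool using (if_then_else_)
open import Data.Empty using (⊥; ⊥-elim)
open import Data.Fin using (Fin; zero; suc; _↑ˡ_; _↑ʳ_; splitAt) renaming (_<_ to _<ᶠ_)
open import Data.Fin.Properties using (any?; splitAt-↑ˡ; splitAt-↑ʳ)
  renaming (_≟_ to _≟ᶠ_; _<?_ to _<ᶠ?_; <-cmp to <ᶠ-cmp)
open import Data.Fin.Subset using (Subset; ∣_∣; ∁; inside; outside) renaming (_∈_ to _∈ˢ_)
open import Data.Fin.Subset.Properties using (∣∁p∣≡n∸∣p∣; ∣p∣≤n; x∉p⇒x∈∁p; x∈∁p⇒x∉p)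
  renaming (_∈?_ to _∈ˢ?_)
open import Data.List using (List; []; _∷_; [_]; _++_; _∷ʳ_; length; map; filter; allFin; tabulate;
  cartesianProduct; concatMap; lookup; reverse; take)
open import Data.List.Extrema.Nat using (min≤xs)
open import Data.List.Membership.Propositional using (_∈_; _∉_; find; lose)
open import Data.List.Membership.Propositional.Properties using (∈-∃++; ∈-++⁺ˡ; ∈-++⁺ʳ; ∈-++⁻;
  ∈-filter⁺; ∈-filter⁻; ∈-allFin; ∈-cartesianProduct⁺; ∈-concatMap⁺; ∈-map⁺; ∈-map⁻; ∈-lookup)
import Data.List.Membership.DecPropositional as DecMembership
open import Data.List.Properties using (length-++; length-map; length-take; length-tabulate;
  ++-assoc; filter-++; filter-reject; unfold-reverse)
open import Data.List.Relation.Binary.Permutation.Propositional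
  using (_↭_; ↭-sym; ↭-trans; ↭-refl; ↭⇒↭ₛ; prep; module PermutationReasoning)
open import Data.List.Relation.Binary.Permutation.Propositional.Properties
  using (∈-resp-↭; ↭-length; ++-comm; filter-↭; ++⁺ˡ; ++⁺ʳ; ↭-reverse; shift)
import Data.List.Relation.Binary.Permutation.Setoid.Properties as Permₛ
open import Data.List.Relation.Unary.All as All using (All; []; _∷_)
import Data.List.Relation.Unary.All.Properties as Allₚ
open import Data.List.Relation.Unary.AllPairs using ([]; _∷_)
open import Data.List.Relation.Unary.Any as Any using (here; there; index)
open import Data.List.Relation.Unary.Any.Properties using (lookup-index)
open import Data.List.Relation.Unary.Linked using (Linked; [-]; _∷_)
open import Data.List.Relation.Unary.Unique.Propositional using (Unique)
open import Data.List.Relation.Unary.Unique.Propositional.Properties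
  using (allFin⁺; filter⁺; cartesianProduct⁺; map⁺; ++⁺; take⁺; Unique[x∷xs]⇒x∉xs)
open import Data.Nat using (ℕ; zero; suc; _+_; _*_; _∸_; _≤_; _<_; z≤n; s≤s; s≤s⁻¹)
open import Data.Nat.Induction using (<-wellFounded)
open import Data.Nat.Properties hiding (_≟_)
open import Data.Nat.Solver using (module +-*-Solver)
open import Data.Product using (_×_; _,_; ∃-syntax; ∃₂; proj₁; proj₂)
open import Data.Sum as Sum using (_⊎_; inj₁; inj₂; [_,_]′)
import Data.Vec as Vec
open import Function using (_∘_; id)
open import Induction.WellFounded using (Acc; acc)
open import Level using (0ℓ)
open import Relation.Binary using (Rel; Symmetric; tri<; tri≈; tri>)
open import Relation.Binary.PropositionalEquality using (_≡_; _≢_; refl; sym; trans; cong; cong₂;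
  subst; subst₂; setoid; ≢-sym; module ≡-Reasoning)
open import Relation.Nullary using (Dec; yes; no; ¬_; contradiction; does)
open import Relation.Nullary.Decidable using (_×-dec_; _⊎-dec_; ¬?; ⊤-dec; ⊥-dec; decidable-stable)
open import Relation.Unary using (Pred; Decidable)
open import Defs
open FinSum +-0-commutativeMonoid using (sum; sum-cong-≗; ∑-distrib-+; ∑-comm)
open +-*-Solver using (solve; _:+_; _:*_; _:=_; con)

-- Remove S with ∣ S ∣ ≤ k, put c = δ − k, and pass from G − S to its Bondy–Chvátal
-- closure C, of order N.  By the edge bound no i with c < i < N / 2 admits i vertices
-- of degree at most i, neither in G − S nor in C.  Hence two non-adjacent vertices of C
-- never both have degree above c + 1, the set A of vertices of degree at most c + 1 has
-- at most c elements, and the rest is a clique B.  If A is not empty, closedness forces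
-- ∣ A ∣ = c, all degrees on A to equal c (so ∣ S ∣ = k), and all vertices of A to have the
-- same neighbourhood X in B.  If ∣ X ∣ = c then A is edgeless and G ⊑ H; if ∣ X ∣ = 1 then
-- G ⊑ L; otherwise A is covered by fewer than ∣ X ∣ paths, and inserting them between
-- vertices of X in a Hamilton cycle of B gives a Hamilton cycle of C.

-- Walks and the Bondy–Chvátal closure

-- If `G − S` has i vertices of degree at most i, these have degree at most i + k in G, so e(G) is
-- at most the size of a clique on the other n - i vertices plus i(i + k). For i = c + 1 this is
-- exactly the size of H at δ + 1, which is the origin of the hypothesis; n ≥ 6(δ + 1) ensures that
-- no larger i < n / 2 allows more. So Pósa's degree condition holds for every i > c, and minimum
-- degree c gives it for 1 ≤ i < c. The obstacle is i = c, where it may really fail: removing k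
-- vertices of the joined clique from either exceptional graph leaves c vertices of degree c. Pósa's
-- theorem is therefore not applicable, and the failure at c has to be analysed. The closure is safe
-- in both directions: adding edges preserves the degree conditions, while an exceptional structure
-- bounds degrees and neighbourhoods from above and hence is inherited by subgraphs.

module _ {A : Set} where

  Unique-resp-↭ : {xs ys : List A} → xs ↭ ys → Unique xs → Unique ys
  Unique-resp-↭ p = Permₛ.Unique-resp-↭ (setoid A) (↭⇒↭ₛ p)

  -- Pigeonhole. Finite sets are duplicate-free lists throughout, and nearly every count below goes
  -- through this comparison.
  unique-⊆⇒length≤ : {xs ys : List A} → Unique xs → (∀ {x} → x ∈ xs → x ∈ ys) → length xs ≤ length ys
  unique-⊆⇒length≤ {[]} _ _ = z≤n
  unique-⊆⇒length≤ {x ∷ xs} (x∉ ∷ uxs) sub with ∈-∃++ (sub (here refl))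
  ... | as , bs , refl = ≤-trans (s≤s (unique-⊆⇒length≤ uxs sub′)) (≤-reflexive (sym (↭-length (shift x as bs))))
    where
    sub′ : ∀ {y} → y ∈ xs → y ∈ as ++ bs
    sub′ y∈ with ∈-resp-↭ (shift x as bs) (sub (there y∈))
    ... | here refl = contradiction refl (All.lookup x∉ y∈)
    ... | there y∈′ = y∈′

  length-filter-¬ : {P : Pred A 0ℓ} (P? : Decidable P) (xs : List A) →
                    length (filter P? xs) + length (filter (¬? ∘ P?) xs) ≡ length xs
  length-filter-¬ P? [] = refl
  length-filter-¬ P? (x ∷ xs) with P? x
  ... | yes _ = cong suc (length-filter-¬ P? xs)
  ... | no _  = trans (+-suc _ _) (cong suc (length-filter-¬ P? xs))

  Unique-++⁻ʳ : ∀ (xs {ys} : List A) → Unique (xs ++ ys) → Unique ys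
  Unique-++⁻ʳ []       u       = u
  Unique-++⁻ʳ (_ ∷ xs) (_ ∷ u) = Unique-++⁻ʳ xs u

  Unique-++⇒disjoint : ∀ {xs ys : List A} {z} → Unique (xs ++ ys) → z ∈ xs → z ∉ ys
  Unique-++⇒disjoint {_ ∷ xs} (z∉ ∷ _) (here refl) z∈ = All.lookup z∉ (∈-++⁺ʳ xs z∈) refl
  Unique-++⇒disjoint (_ ∷ u) (there p) z∈ = Unique-++⇒disjoint u p z∈

  ∉⇒Unique-∷ : ∀ {x} {xs : List A} → x ∉ xs → Unique xs → Unique (x ∷ xs)
  ∉⇒Unique-∷ x∉ u = All.tabulate (λ { y∈ refl → x∉ y∈ }) ∷ u

  filter-++-filter-¬-↭ : {P : Pred A 0ℓ} (P? : Decidable P) (xs : List A) →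
                         filter P? xs ++ filter (¬? ∘ P?) xs ↭ xs
  filter-++-filter-¬-↭ P? [] = ↭-refl
  filter-++-filter-¬-↭ P? (x ∷ xs) with P? x
  ... | yes _ = prep x (filter-++-filter-¬-↭ P? xs)
  ... | no _  = ↭-trans (shift x (filter P? xs) _) (prep x (filter-++-filter-¬-↭ P? xs))

  -- Both ends and the vertex list are indices, so that cutting, rotating and reversing are tracked
  -- by the type and covering all vertices becomes a permutation of the list.
  data Walk (R : Rel A 0ℓ) : A → List A → A → Set where
    [_]ʷ : ∀ x → Walk R x [ x ] x
    _∷_  : ∀ {x y z ys} → R x y → Walk R y ys z → Walk R x (x ∷ ys) z

  module _ {R : Rel A 0ℓ} where

    append : ∀ {x y z w xs zs} → Walk R x xs y → R y z → Walk R z zs w → Walk R x (xs ++ zs) w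
    append [ _ ]ʷ  r v = r ∷ v
    append (s ∷ w) r v = s ∷ append w r v

    reverseʷ : Symmetric R → ∀ {x y xs} → Walk R x xs y → Walk R y (reverse xs) x
    reverseʷ sm [ x ]ʷ = [ x ]ʷ
    reverseʷ sm {x} {y} (_∷_ {ys = ys} r w) =
      subst (λ zs → Walk R y zs x) (sym (unfold-reverse x ys)) (append (reverseʷ sm w) (sm r) [ x ]ʷ)

    last∈ : ∀ {x y xs} → Walk R x xs y → y ∈ xs
    last∈ [ _ ]ʷ  = here refl
    last∈ (_ ∷ w) = there (last∈ w)

    head∈ : ∀ {x y xs} → Walk R x xs y → x ∈ xs
    head∈ [ _ ]ʷ  = here refl
    head∈ (_ ∷ _) = here refl

    Walk⇒Linked : ∀ {x y z xs} → Walk R x xs y → R y z → Linked R (xs ∷ʳ z)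
    Walk⇒Linked [ _ ]ʷ             r = r ∷ [-]
    Walk⇒Linked (s ∷ [ _ ]ʷ)       r = s ∷ Walk⇒Linked [ _ ]ʷ r
    Walk⇒Linked (s ∷ w@(_ ∷ _))    r = s ∷ Walk⇒Linked w r

    private
      drop : ∀ {l p q} → l + 1 ≤ p + suc q → l + 0 ≤ p + q
      drop {l} {p} {q} le = s≤s⁻¹ (subst₂ _≤_ (+-suc l 0) (+-suc p q) le)

      extend : ∀ {P Q : Pred A 0ℓ} {x y z xs} → R x y →
        (∃₂ λ a b → ∃₂ λ ys zs → Walk R y ys a × Walk R b zs z × P a × Q b × xs ≡ ys ++ zs) →
        ∃₂ λ a b → ∃₂ λ ys zs → Walk R x ys a × Walk R b zs z × P a × Q b × x ∷ xs ≡ ys ++ zs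
      extend {x = x} r (a , b , as , bs , w₁ , w₂ , Pa , Qb , eq) =
        a , b , x ∷ as , bs , r ∷ w₁ , w₂ , Pa , Qb , cong (x ∷_) eq

    -- A walk of ℓ vertices has ℓ − 1 steps; if the steps leaving a P-vertex and
    -- those entering a Q-vertex number at least ℓ, some step does both.  (The last
    -- vertex is left by no step and the first is entered by none, so ¬ P z is
    -- assumed and the contribution of x to the Q-count is compensated.)
    crossing : {P Q : Pred A 0ℓ} (P? : Decidable P) (Q? : Decidable Q) →
      ∀ {x xs z} → Walk R x xs z → ¬ P z →
      length xs + length (filter Q? [ x ]) ≤ length (filter P? xs) + length (filter Q? xs) →
      ∃₂ λ y y′ → ∃₂ λ ys zs → Walk R x ys y × Walk R y′ zs z × P y × Q y′ × xs ≡ ys ++ zs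
    crossing P? Q? [ z ]ʷ ¬Pz le with P? z
    ... | yes Pz = contradiction Pz ¬Pz
    ... | no _   = contradiction le (n≮n _)
    crossing P? Q? {x} (_∷_ {y = y} {ys = ys} r w) ¬Pz le
      with P? x | Q? x | Q? y | crossing P? Q? w ¬Pz
    ... | yes Px | _     | yes Qy | _  = x , y , [ x ] , ys , [ x ]ʷ , w , Px , Qy , refl
    ... | yes Px | yes _ | no _   | ih = extend r (ih (drop (s≤s⁻¹ le)))
    ... | yes Px | no _  | no _   | ih = extend r (ih (s≤s⁻¹ le))
    ... | no _   | yes _ | yes _  | ih =
      extend r (ih (s≤s⁻¹ (subst (suc (length ys + 1) ≤_) (+-suc (length (filter P? ys)) _) le)))
    ... | no _   | no _  | yes _  | ih =
      extend r (ih (subst (_≤ length (filter P? ys) + length (filter Q? ys)) (sym (+-suc (length ys) 0)) le))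
    ... | no _   | yes _ | no _   | ih = extend r (ih (≤-trans (n≤1+n _) (drop le)))
    ... | no _   | no _  | no _   | ih = extend r (ih (≤-trans (n≤1+n _) le))

length-allFin : ∀ n → length (allFin n) ≡ n
length-allFin n = length-tabulate id

-- The permutation expresses distinctness and coverage at once. A single edge on two vertices also
-- qualifies, hence the bound `3 ≤ n` in the conversion to `Hamiltonian`.
HamiltonCycle : ∀ {n} → Rel (Fin n) 0ℓ → Set
HamiltonCycle {n} R = ∃₂ λ x y → ∃[ xs ] Walk R x xs y × R y x × xs ↭ allFin n

HamiltonCycle⇒Hamiltonian : ∀ {n} (G : Graph n) → 3 ≤ n → HamiltonCycle (Adj G) → Hamiltonian G
HamiltonCycle⇒Hamiltonian {n} G 3≤n (x , y , xs , w , r , p) = unfold w p (Walk⇒Linked w r)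
  where
  unfold : ∀ {zs} → Walk (Adj G) x zs y → zs ↭ allFin n → Linked (Adj G) (zs ∷ʳ x) → Hamiltonian G
  unfold {z ∷ zs} v q l = z , zs , record
      { length≥3 = subst (3 ≤_) (sym (trans (↭-length q) (length-allFin n))) 3≤n
      ; distinct = Unique-resp-↭ (↭-sym q) (allFin⁺ n)
      ; closed   = subst (λ h → Linked (Adj G) (z ∷ zs ∷ʳ h)) (head≡ v) l
      } , λ u → ∈-resp-↭ (↭-sym q) (∈-allFin u)
    where
    head≡ : ∀ {a b c cs} → Walk (Adj G) a (c ∷ cs) b → a ≡ c
    head≡ [ _ ]ʷ  = refl
    head≡ (_ ∷ _) = refl

infix 4 _⊆ᴳ_

_⊆ᴳ_ : ∀ {n} → Graph n → Graph n → Set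
G ⊆ᴳ H = ∀ {u v} → Adj G u v → Adj H u v

module _ {n} (G : Graph n) where

  -- A Hamilton path from b to a turns into a Hamilton cycle by exchanging a step
  -- y → y′ with a ~ y and b ~ y′ for the edges a y and b y′.
  ore : ∀ {a b xs} → Walk (Adj G) b xs a → xs ↭ allFin n →
        n ≤ degree G a + degree G b → HamiltonCycle (Adj G)
  ore {a} {b} {xs} w p n≤ with crossing (adj? G a) (adj? G b) w (irrefl G a) le
    where
    count : ∀ v → degree G v ≡ length (filter (adj? G v) xs)
    count v = sym (↭-length (filter-↭ (adj? G v) p))
    le : length xs + length (filter (adj? G b) [ b ]) ≤
         length (filter (adj? G a) xs) + length (filter (adj? G b) xs)
    le rewrite filter-reject (adj? G b) {b} {[]} (irrefl G b) | +-identityʳ (length xs)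
             | ↭-length p | length-allFin n | sym (count a) | sym (count b) = n≤
  ... | y , y′ , ys , zs , w₁ , w₂ , ay , by′ , refl =
    b , y′ , ys ++ reverse zs , append w₁ (adj-sym G ay) (reverseʷ (adj-sym G) w₂) , adj-sym G by′ ,
    ↭-trans (++⁺ˡ ys (↭-reverse zs)) p

module _ {n} (G : Graph n) {u v : Fin n} (u≢v : u ≢ v) where

  addEdge : Graph n
  addEdge = record
    { Adj     = λ x y → Adj G x y ⊎ ((x ≡ u × y ≡ v) ⊎ (x ≡ v × y ≡ u))
    ; adj?    = λ x y → adj? G x y ⊎-dec
                  (((x ≟ᶠ u) ×-dec (y ≟ᶠ v)) ⊎-dec ((x ≟ᶠ v) ×-dec (y ≟ᶠ u)))
    ; adj-sym = λ { (inj₁ r) → inj₁ (adj-sym G r)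
                  ; (inj₂ (inj₁ (p , q))) → inj₂ (inj₂ (q , p))
                  ; (inj₂ (inj₂ (p , q))) → inj₂ (inj₁ (q , p)) }
    ; irrefl  = λ { x (inj₁ r) → irrefl G x r
                  ; x (inj₂ (inj₁ (p , q))) → u≢v (trans (sym p) q)
                  ; x (inj₂ (inj₂ (p , q))) → u≢v (trans (sym q) p) }
    }

  private
    R⁺ : Rel (Fin n) 0ℓ
    R⁺ = Adj addEdge

    New : Rel (Fin n) 0ℓ
    New x y = (x ≡ u × y ≡ v) ⊎ (x ≡ v × y ≡ u)

  firstNew : ∀ {x y xs} → Walk R⁺ x xs y → Walk (Adj G) x xs y ⊎
    ∃₂ λ a b → ∃₂ λ ys zs → Walk R⁺ x ys a × New a b × Walk R⁺ b zs y × xs ≡ ys ++ zs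
  firstNew [ x ]ʷ = inj₁ [ x ]ʷ
  firstNew (_∷_ {x = x} (inj₂ new) w) = inj₂ (x , _ , [ x ] , _ , [ x ]ʷ , new , w , refl)
  firstNew (_∷_ {x = x} (inj₁ r) w) with firstNew w
  ... | inj₁ w′ = inj₁ (r ∷ w′)
  ... | inj₂ (a , b , ys , zs , w₁ , new , w₂ , refl) =
    inj₂ (a , b , x ∷ ys , zs , inj₁ r ∷ w₁ , new , w₂ , refl)

  avoids⇒Walk : ∀ {a b} → New a b → ∀ {x y xs} → b ∉ xs → Walk R⁺ x xs y → Walk (Adj G) x xs y
  avoids⇒Walk new b∉ [ x ]ʷ = [ x ]ʷ
  avoids⇒Walk new b∉ (inj₁ r ∷ w) = r ∷ avoids⇒Walk new (b∉ ∘ there) w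
  avoids⇒Walk new b∉ (inj₂ n′ ∷ w) = ⊥-elim (clash new n′)
    where
    clash : New _ _ → New _ _ → ⊥
    clash (inj₁ (refl , refl)) (inj₁ (refl , refl)) = b∉ (there (head∈ w))
    clash (inj₁ (refl , refl)) (inj₂ (refl , refl)) = b∉ (here refl)
    clash (inj₂ (refl , refl)) (inj₁ (refl , refl)) = b∉ (here refl)
    clash (inj₂ (refl , refl)) (inj₂ (refl , refl)) = b∉ (there (head∈ w))

  -- The path starts at b and never returns there, so only its first step can use the added edge.
  -- That step would lead to a, which is also the last vertex, and the path would have just two
  -- vertices.
  closesNew⇒Walk : ∀ {a b xs} → New a b → 3 ≤ length xs → Unique xs → Walk R⁺ b xs a → Walk (Adj G) b xs a
  closesNew⇒Walk new (s≤s ()) _ [ _ ]ʷ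
  closesNew⇒Walk new _ uq (inj₁ r ∷ w) = r ∷ avoids⇒Walk new (Unique[x∷xs]⇒x∉xs uq) w
  closesNew⇒Walk new 3≤ (_ ∷ uq) (inj₂ n′ ∷ w) with other new n′
    where
    other : ∀ {a b z} → New a b → New b z → z ≡ a
    other (inj₁ (refl , refl)) (inj₁ (p , refl)) = ⊥-elim (u≢v (sym p))
    other (inj₁ (refl , refl)) (inj₂ (refl , refl)) = refl
    other (inj₂ (refl , refl)) (inj₁ (refl , refl)) = refl
    other (inj₂ (refl , refl)) (inj₂ (p , refl)) = ⊥-elim (u≢v p)
  closesNew⇒Walk new (s≤s (s≤s ())) _ (inj₂ _ ∷ [ _ ]ʷ) | refl
  closesNew⇒Walk new _ (_ ∷ uq) (inj₂ _ ∷ (_ ∷ w)) | refl = contradiction (last∈ w) (Unique[x∷xs]⇒x∉xs uq)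

  addEdge-HamiltonCycle : 3 ≤ n → n ≤ degree G u + degree G v →
                          HamiltonCycle R⁺ → HamiltonCycle (Adj G)
  addEdge-HamiltonCycle 3≤n n≤ (x , y , xs , w , r , p) = byNew (firstNew w) r
    where
    degreeSum≥n : ∀ {a b} → New a b → n ≤ degree G a + degree G b
    degreeSum≥n (inj₁ (refl , refl)) = n≤
    degreeSum≥n (inj₂ (refl , refl)) = subst (n ≤_) (+-comm (degree G u) _) n≤
    fromPath : ∀ {a b xs} → New a b → Walk R⁺ b xs a → xs ↭ allFin n → HamiltonCycle (Adj G)
    fromPath new w p = ore G
      (closesNew⇒Walk new (subst (3 ≤_) (sym (trans (↭-length p) (length-allFin n))) 3≤n)
         (Unique-resp-↭ (↭-sym p) (allFin⁺ n)) w) p (degreeSum≥n new)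
    byNew : Walk (Adj G) x xs y ⊎
            (∃₂ λ a b → ∃₂ λ ys zs → Walk R⁺ x ys a × New a b × Walk R⁺ b zs y × xs ≡ ys ++ zs) →
            R⁺ y x → HamiltonCycle (Adj G)
    byNew (inj₁ w′) (inj₁ r′)  = x , y , xs , w′ , r′ , p
    byNew (inj₁ w′) (inj₂ new) = ore G w′ p (degreeSum≥n new)
    -- Rotate the cycle so that the added edge becomes the closing step.
    byNew (inj₂ (a , b , ys , zs , w₁ , new , w₂ , refl)) r =
      fromPath new (append w₂ r w₁) (↭-trans (++-comm zs ys) p)

OreClosed : ∀ {n} → Graph n → Set
OreClosed {n} G = ∀ u v → u ≢ v → ¬ Adj G u v → degree G u + degree G v < n

private
  pairs : ∀ n → List (Fin n × Fin n)
  pairs n = cartesianProduct (allFin n) (allFin n)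

  nonEdge? : ∀ {n} (G : Graph n) → Decidable (λ (p : Fin n × Fin n) → ¬ Adj G (proj₁ p) (proj₂ p))
  nonEdge? G (u , v) = ¬? (adj? G u v)

  nonEdges : ∀ {n} → Graph n → List (Fin n × Fin n)
  nonEdges {n} G = filter (nonEdge? G) (pairs n)

  addEdge-nonEdges : ∀ {n} (G : Graph n) {u v} (u≢v : u ≢ v) → ¬ Adj G u v →
                     length (nonEdges (addEdge G u≢v)) < length (nonEdges G)
  addEdge-nonEdges {n} G {u} {v} u≢v ¬uv = unique-⊆⇒length≤ {xs = (u , v) ∷ nonEdges (addEdge G u≢v)}
    (All.tabulate new∉ ∷ filter⁺ (nonEdge? (addEdge G u≢v)) (cartesianProduct⁺ (allFin⁺ n) (allFin⁺ n))) sub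
    where
    mem : ∀ p → p ∈ pairs n
    mem (a , b) = ∈-cartesianProduct⁺ (∈-allFin a) (∈-allFin b)
    new∉ : ∀ {p} → p ∈ nonEdges (addEdge G u≢v) → (u , v) ≢ p
    new∉ p∈ refl = proj₂ (∈-filter⁻ (nonEdge? (addEdge G u≢v)) {xs = pairs n} p∈) (inj₂ (inj₁ (refl , refl)))
    sub : ∀ {p} → p ∈ (u , v) ∷ nonEdges (addEdge G u≢v) → p ∈ nonEdges G
    sub (here refl) = ∈-filter⁺ (nonEdge? G) (mem _) ¬uv
    sub (there p∈)  = ∈-filter⁺ (nonEdge? G) (mem _)
      (proj₂ (∈-filter⁻ (nonEdge? (addEdge G u≢v)) {xs = pairs n} p∈) ∘ inj₁)

oreClosure : ∀ {n} → 3 ≤ n → (G : Graph n) →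
  ∃[ C ] G ⊆ᴳ C × OreClosed C × (HamiltonCycle (Adj C) → HamiltonCycle (Adj G))
oreClosure {n} 3≤n G = go G (<-wellFounded _)
  where
  go : ∀ G → Acc _<_ (length (nonEdges G)) →
       ∃[ C ] G ⊆ᴳ C × OreClosed C × (HamiltonCycle (Adj C) → HamiltonCycle (Adj G))
  go G (acc rec) with any? (λ u → any? (λ v →
       ¬? (u ≟ᶠ v) ×-dec ¬? (adj? G u v) ×-dec (n ≤? degree G u + degree G v)))
  ... | no none = G , id , (λ u v u≢v ¬uv → ≰⇒> λ le → none (u , v , u≢v , ¬uv , le)) , id
  ... | yes (u , v , u≢v , ¬uv , le) with go (addEdge G u≢v) (rec (addEdge-nonEdges G u≢v ¬uv))
  ... | C , sub , closed , back =
    C , sub ∘ inj₁ , closed , addEdge-HamiltonCycle G u≢v 3≤n le ∘ back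

-- Cliques with attached paths

module _ {n} (G : Graph n) where

  record Path : Set where
    constructor path
    field
      {start end} : Fin n
      {vertices}  : List (Fin n)
      walk        : Walk (Adj G) start vertices end

  open Path

  ⋃ : List Path → List (Fin n)
  ⋃ = concatMap vertices

  singletons : List (Fin n) → List Path
  singletons = map (λ v → path [ v ]ʷ)

  ⋃-singletons : ∀ U → ⋃ (singletons U) ≡ U
  ⋃-singletons []      = refl
  ⋃-singletons (u ∷ U) = cong (u ∷_) (⋃-singletons U)

  Clique : List (Fin n) → Set
  Clique B = ∀ {u v} → u ∈ B → v ∈ B → u ≢ v → Adj G u v

  cliqueWalk : ∀ {b bs} → Unique (b ∷ bs) → Clique (b ∷ bs) →
               ∃[ e ] e ∈ b ∷ bs × Walk (Adj G) b (b ∷ bs) e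
  cliqueWalk {b} {[]} _ _ = b , here refl , [ b ]ʷ
  cliqueWalk {b} {b′ ∷ bs} ((b≢ ∷ _) ∷ u) cl with cliqueWalk u (λ p q → cl (there p) (there q))
  ... | e , e∈ , w = e , there e∈ , cl (here refl) (there (here refl)) b≢ ∷ w

  Attached : List (Fin n) → Path → Set
  Attached X P = ∀ x → x ∈ X → Adj G x (start P) × Adj G x (end P)

  -- Each path is entered from the current vertex of X and left to the next one, so p paths take p +
  -- 1 vertices of X; x is the first of them. What is left of the clique is walked at the end, and
  -- recording that e lies in the clique allows the walk to be closed.
  weave : ∀ Ps {x X Y} → length Ps ≤ length X → Unique (x ∷ X ++ Y) → Clique (x ∷ X ++ Y) →
          All (Attached (x ∷ X)) Ps →
          ∃₂ λ e zs → e ∈ x ∷ X ++ Y × Walk (Adj G) x (x ∷ zs) e × zs ↭ ⋃ Ps ++ X ++ Y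
  weave [] {X = X} {Y} _ u cl _ with cliqueWalk u cl
  ... | e , e∈ , w = e , X ++ Y , e∈ , w , ↭-refl
  weave (P ∷ Ps) {x} {x′ ∷ X} {Y} (s≤s le) (_ ∷ u) cl (a ∷ as)
    with weave Ps le u (λ p q → cl (there p) (there q)) (All.map (λ b z p → b z (there p)) as)
  ... | e , zs , e∈ , w , p =
    e , vertices P ++ x′ ∷ zs , there e∈ ,
    proj₁ (a _ (here refl)) ∷ append (walk P) (adj-sym G (proj₂ (a _ (there (here refl))))) w ,
    (begin
      vertices P ++ x′ ∷ zs                 ↭⟨ ++⁺ˡ (vertices P) (prep x′ p) ⟩
      vertices P ++ x′ ∷ ⋃ Ps ++ X ++ Y     ↭⟨ ++⁺ˡ (vertices P) (↭-sym (shift x′ (⋃ Ps) (X ++ Y))) ⟩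
      vertices P ++ ⋃ Ps ++ x′ ∷ X ++ Y     ≡⟨ sym (++-assoc (vertices P) (⋃ Ps) _) ⟩
      (vertices P ++ ⋃ Ps) ++ x′ ∷ X ++ Y   ∎)
    where open PermutationReasoning

  clique∪paths⇒HamiltonCycle : 3 ≤ n → ∀ Ps {x X Y} → length Ps ≤ length X → Clique (x ∷ X ++ Y) →
    All (Attached (x ∷ X)) Ps → ⋃ Ps ++ x ∷ X ++ Y ↭ allFin n → HamiltonCycle (Adj G)
  clique∪paths⇒HamiltonCycle 3≤n Ps {x} {X} {Y} le cl as p
    with weave Ps le (Unique-++⁻ʳ (⋃ Ps) (Unique-resp-↭ (↭-sym p) (allFin⁺ n))) cl as
  ... | e , zs , e∈ , w , q = x , e , x ∷ zs , w , cl e∈ (here refl) (e≢x w uq len) , q′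
    where
    q′ : x ∷ zs ↭ allFin n
    q′ = ↭-trans (prep x q) (↭-trans (↭-sym (shift x (⋃ Ps) (X ++ Y))) p)
    uq : Unique (x ∷ zs)
    uq = Unique-resp-↭ (↭-sym q′) (allFin⁺ n)
    len : 3 ≤ length (x ∷ zs)
    len = subst (3 ≤_) (sym (trans (↭-length q′) (length-allFin n))) 3≤n
    e≢x : ∀ {e x zs} → Walk (Adj G) x (x ∷ zs) e → Unique (x ∷ zs) → 3 ≤ length (x ∷ zs) → e ≢ x
    e≢x [ _ ]ʷ  _ (s≤s ()) _
    e≢x (_ ∷ w) u _ refl = contradiction (last∈ w) (Unique[x∷xs]⇒x∉xs u)

  -- Grow one path greedily until r vertices are left over: while there are more, the
  -- bound r + 1 on the non-neighbours inside A extends it.  The same bound, applied to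
  -- a left-over vertex, then gives an edge joining two of the r + 1 paths.
  module PathCover (A : List (Fin n)) (uA : Unique A) (r : ℕ)
    (nonNbrs : ∀ {x T} → x ∈ A → Unique T → (∀ {y} → y ∈ T → y ∈ A × ¬ Adj G x y) → length T ≤ suc r) where

    grow : ∀ m {q q′ xs U} → Walk (Adj G) q xs q′ → xs ++ U ↭ A → length U ≡ m + r →
           ∃₂ λ s t → ∃₂ λ ys V → Walk (Adj G) s ys t × ys ++ V ↭ A × length V ≡ r
    grow zero w p eq = _ , _ , _ , _ , w , p , eq
    grow (suc m) {q} {q′} {xs} {U} w p eq with Any.any? (adj? G q) U
    ... | yes adj with find adj
    ...   | u , u∈ , qu with ∈-∃++ u∈
    ...     | U₁ , U₂ , refl = grow m (adj-sym G qu ∷ w)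
                (↭-trans (↭-sym (shift u xs (U₁ ++ U₂))) (↭-trans (++⁺ˡ xs (↭-sym (shift u U₁ U₂))) p))
                (suc-injective (trans (sym (↭-length (shift u U₁ U₂))) eq))
    grow (suc m) {q} {q′} {xs} {U} w p eq | no none =
      contradiction (nonNbrs q∈A (∉⇒Unique-∷ q∉U (Unique-++⁻ʳ xs uq)) sub)
                    (<⇒≱ (s≤s (subst (suc r ≤_) (sym eq) (s≤s (m≤n+m r m)))))
      where
      uq : Unique (xs ++ U)
      uq = Unique-resp-↭ (↭-sym p) uA
      q∈A : q ∈ A
      q∈A = ∈-resp-↭ p (∈-++⁺ˡ (head∈ w))
      q∉U : q ∉ U
      q∉U = Unique-++⇒disjoint uq (head∈ w)
      sub : ∀ {y} → y ∈ q ∷ U → y ∈ A × ¬ Adj G q y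
      sub (here refl) = q∈A , irrefl G q
      sub (there y∈)  = ∈-resp-↭ p (∈-++⁺ʳ xs y∈) , λ qy → none (lose y∈ qy)

    join : ∀ {q q′ xs y V} → Walk (Adj G) q xs q′ → q ≢ q′ → xs ++ y ∷ V ↭ A → suc (length V) ≡ r →
           ∃[ Ps ] length Ps ≤ r × ⋃ Ps ↭ A
    join {q} {q′} {xs} {y} {V} w q≢q′ p eq with adj? G y q | adj? G q′ y | Any.any? (adj? G y) V
    ... | yes yq | _ | _ = path (yq ∷ w) ∷ singletons V ,
      ≤-reflexive (trans (cong suc (length-map _ V)) eq) ,
      (begin
        (y ∷ xs) ++ ⋃ (singletons V) ≡⟨ cong ((y ∷ xs) ++_) (⋃-singletons V) ⟩
        y ∷ xs ++ V                  ↭⟨ ↭-sym (shift y xs V) ⟩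
        xs ++ y ∷ V                  ↭⟨ p ⟩
        A                            ∎)
      where open PermutationReasoning
    ... | no _ | yes q′y | _ = path (append w q′y [ y ]ʷ) ∷ singletons V ,
      ≤-reflexive (trans (cong suc (length-map _ V)) eq) ,
      (begin
        (xs ++ [ y ]) ++ ⋃ (singletons V) ≡⟨ cong ((xs ++ [ y ]) ++_) (⋃-singletons V) ⟩
        (xs ++ [ y ]) ++ V                ≡⟨ ++-assoc xs [ y ] V ⟩
        xs ++ y ∷ V                       ↭⟨ p ⟩
        A                                 ∎)
      where open PermutationReasoning
    ... | no _ | no _ | yes adj with find adj
    ...   | u , u∈ , yu with ∈-∃++ u∈
    ...     | V₁ , V₂ , refl = path w ∷ path (yu ∷ [ u ]ʷ) ∷ singletons (V₁ ++ V₂) ,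
      ≤-reflexive (trans (cong (2 +_) (length-map _ (V₁ ++ V₂))) (trans (cong suc (sym (↭-length (shift u V₁ V₂)))) eq)) ,
      (begin
        xs ++ y ∷ u ∷ ⋃ (singletons (V₁ ++ V₂)) ≡⟨ cong (λ Z → xs ++ y ∷ u ∷ Z) (⋃-singletons (V₁ ++ V₂)) ⟩
        xs ++ y ∷ u ∷ V₁ ++ V₂                  ↭⟨ ++⁺ˡ xs (prep y (↭-sym (shift u V₁ V₂))) ⟩
        xs ++ y ∷ V₁ ++ u ∷ V₂                  ↭⟨ p ⟩
        A                                       ∎)
      where open PermutationReasoning
    join {q} {q′} {xs} {y} {V} w q≢q′ p eq | no ¬yq | no ¬q′y | no none =
      -- V has r - 1 entries, so q, q′, y and V are r + 2 non-neighbours of y (y itself included),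
      -- one too many.
      contradiction (nonNbrs y∈A u sub) (<⇒≱ (s≤s (s≤s (≤-reflexive (sym eq)))))
      where
      uq : Unique (xs ++ y ∷ V)
      uq = Unique-resp-↭ (↭-sym p) uA
      y∈A : y ∈ A
      y∈A = ∈-resp-↭ p (∈-++⁺ʳ xs (here refl))
      q∉ : q ∉ y ∷ V
      q∉ = Unique-++⇒disjoint uq (head∈ w)
      q′∉ : q′ ∉ y ∷ V
      q′∉ = Unique-++⇒disjoint uq (last∈ w)
      u : Unique (q ∷ q′ ∷ y ∷ V)
      u = ∉⇒Unique-∷ (λ { (here e) → q≢q′ e ; (there q∈) → q∉ q∈ }) (∉⇒Unique-∷ q′∉ (Unique-++⁻ʳ xs uq))
      sub : ∀ {z} → z ∈ q ∷ q′ ∷ y ∷ V → z ∈ A × ¬ Adj G y z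
      sub (here refl)                 = ∈-resp-↭ p (∈-++⁺ˡ (head∈ w)) , ¬yq
      sub (there (here refl))         = ∈-resp-↭ p (∈-++⁺ˡ (last∈ w)) , ¬q′y ∘ adj-sym G
      sub (there (there (here refl))) = y∈A , irrefl G y
      sub (there (there (there z∈)))  = ∈-resp-↭ p (∈-++⁺ʳ xs (there z∈)) , λ yz → none (lose z∈ yz)

    -- `1 ≤ r` provides a left-over vertex to join. `suc r < length A` leaves at least two vertices
    -- on the grown path, so its ends are distinct, as `join` requires.
    pathCover : 1 ≤ r → suc r < length A → ∃[ Ps ] length Ps ≤ r × ⋃ Ps ↭ A
    pathCover = cover A refl
      where
      ends≢ : ∀ {s t ys} → Walk (Adj G) s ys t → Unique ys → 2 ≤ length ys → s ≢ t
      ends≢ [ _ ]ʷ  _ (s≤s ()) _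
      ends≢ (_ ∷ w) u _ refl = contradiction (last∈ w) (Unique[x∷xs]⇒x∉xs u)
      cover : ∀ A′ → A′ ≡ A → 1 ≤ r → suc r < length A′ → ∃[ Ps ] length Ps ≤ r × ⋃ Ps ↭ A
      cover (a ∷ A′) refl 1≤r (s≤s r<) with grow (length A′ ∸ r) [ a ]ʷ ↭-refl (sym (m∸n+n≡m (<⇒≤ r<)))
      ... | s , t , ys , [] , w , p , refl = contradiction 1≤r λ ()
      ... | s , t , ys , y ∷ V , w , p , eq = join w (ends≢ w uys 2≤ys) p eq
        where
        uys : Unique ys
        uys = Unique-++⁻ʳ (y ∷ V) (Unique-resp-↭ (↭-trans (↭-sym p) (++-comm ys (y ∷ V))) uA)
        2≤ys : 2 ≤ length ys
        2≤ys = +-cancelʳ-≤ r 2 (length ys) (≤-trans (s≤s r<)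
                 (≤-reflexive (trans (sym (↭-length p)) (trans (length-++ ys) (cong (length ys +_) eq)))))

-- The structure of closed graphs

-- Pósa's condition at i. Quantifying over lists of low vertices lets it pass to supergraphs
-- directly, since a vertex that is low there is low here.
Few : ∀ {n} → Graph n → ℕ → Set
Few {n} G i = ∀ T → Unique T → (∀ {v} → v ∈ T → degree G v ≤ i) → length T < i

-- X is what A sees outside itself; the alternatives lead to H[_,_,_], where A is
-- edgeless because it is disjoint from X, and to L[_,_,_].
Isolation : ∀ {n} → Graph n → (A X : List (Fin n)) → ℕ → Set
Isolation G A X c = (length X ≡ c × (∀ {u v} → u ∈ A → Adj G u v → v ∈ X))
                  ⊎ (length X ≡ 1 × (∀ {u v} → u ∈ A → Adj G u v → v ∈ A ⊎ v ∈ X))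

-- All graph conditions are upper bounds, so the structure found in the closure holds in the
-- original graph too. `degrees` is what later shows that exactly k vertices were removed.
record Exceptional {n} (G : Graph n) (c : ℕ) : Set where
  field
    A X       : List (Fin n)
    uniqueA   : Unique A
    uniqueX   : Unique X
    disjoint  : ∀ {v} → v ∈ A → v ∉ X
    sizeA     : length A ≡ c
    degrees   : ∀ {v} → v ∈ A → degree G v ≤ c
    isolation : Isolation G A X c

module Closed {n} (C : Graph n) (closed : OreClosed C) (c : ℕ) (large : 2 * c + 3 ≤ n)
  (c≤deg : ∀ v → c ≤ degree C v) (few : ∀ i → c < i → i + i < n → Few C i) where

  private
    d : Fin n → ℕ
    d = degree C

  -- At a non-adjacent pair u, v of maximal degree sum with d u ≤ d v, the
  -- non-neighbours of v are at least d u vertices of degree at most d u.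
  noHighNonEdge : ∀ fuel {u v} → n ≤ fuel + (d u + d v) → u ≢ v → ¬ Adj C u v → suc c < d u → d u ≤ d v → ⊥
  noHighNonEdge zero le u≢v ¬uv du uv = <⇒≱ (closed _ _ u≢v ¬uv) le
  noHighNonEdge (suc fuel) {u} {v} le u≢v ¬uv du uv = <⇒≱ (few (d u) (<⇒≤ du) (≤-<-trans (+-monoʳ-≤ (d u) uv) sum<n) T uT low) du≤T
    where
    sum<n : d u + d v < n
    sum<n = closed u v u≢v ¬uv
    T? : Decidable (λ w → w ≢ v × ¬ Adj C v w)
    T? w = ¬? (w ≟ᶠ v) ×-dec ¬? (adj? C v w)
    T : List (Fin n)
    T = filter T? (allFin n)
    uT : Unique T
    uT = filter⁺ T? (allFin⁺ n)
    du≤T : d u ≤ length T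
    du≤T = +-cancelʳ-≤ (d v) (d u) (length T) (s≤s⁻¹ (≤-trans sum<n (begin
      n                                                        ≡⟨ sym (length-allFin n) ⟩
      length (allFin n)                                        ≡⟨ sym (length-filter-¬ (adj? C v) (allFin n)) ⟩
      d v + length (filter (¬? ∘ adj? C v) (allFin n))         ≤⟨ +-monoʳ-≤ (d v) (unique-⊆⇒length≤ (filter⁺ _ (allFin⁺ n)) sub) ⟩
      d v + suc (length T)                                     ≡⟨ +-suc (d v) _ ⟩
      suc (d v + length T)                                     ≡⟨ cong suc (+-comm (d v) _) ⟩
      suc (length T + d v)                                     ∎)))
      where
      open ≤-Reasoning
      sub : ∀ {w} → w ∈ filter (¬? ∘ adj? C v) (allFin n) → w ∈ v ∷ T
      sub {w} w∈ with w ≟ᶠ v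
      ... | yes w≡v = here w≡v
      ... | no w≢v = there (∈-filter⁺ T? (∈-allFin w)
                       (w≢v , proj₂ (∈-filter⁻ (¬? ∘ adj? C v) {xs = allFin n} w∈)))
    low : ∀ {w} → w ∈ T → d w ≤ d u
    low {w} w∈ with d w ≤? d u
    ... | yes le = le
    -- Replacing u by w raises the degree sum, which costs one unit of fuel; fuel measures how far
    -- the sum may still be from n. The two cases put the smaller degree first.
    ... | no ≰ with proj₂ (∈-filter⁻ T? {xs = allFin n} w∈) | ≤-total (d w) (d v)
    ...   | w≢v , ¬vw | inj₁ wv = ⊥-elim (noHighNonEdge fuel (≤-trans le (≤-trans (≤-reflexive (sym (+-suc fuel _)))
              (+-monoʳ-≤ fuel (+-monoˡ-≤ (d v) (≰⇒> ≰))))) w≢v (¬vw ∘ adj-sym C) (<-trans du (≰⇒> ≰)) wv)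
    ...   | w≢v , ¬vw | inj₂ vw = ⊥-elim (noHighNonEdge fuel (≤-trans le (≤-trans (≤-reflexive (sym (+-suc fuel _)))
              (+-monoʳ-≤ fuel (≤-trans (+-monoˡ-≤ (d v) (≰⇒> ≰)) (≤-reflexive (+-comm (d w) (d v)))))))
              (≢-sym w≢v) ¬vw (<-≤-trans du uv) vw)

  highAdjacent : ∀ {u v} → u ≢ v → suc c < d u → suc c < d v → Adj C u v
  highAdjacent {u} {v} u≢v du dv with adj? C u v | ≤-total (d u) (d v)
  ... | yes uv | _       = uv
  ... | no ¬uv | inj₁ le = ⊥-elim (noHighNonEdge n (m≤m+n n _) u≢v ¬uv du le)
  ... | no ¬uv | inj₂ le = ⊥-elim (noHighNonEdge n (m≤m+n n _) (≢-sym u≢v) (¬uv ∘ adj-sym C) dv le)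

  low? : Decidable (λ v → d v ≤ suc c)
  low? v = d v ≤? suc c

  A B : List (Fin n)
  A = filter low? (allFin n)
  B = filter (¬? ∘ low?) (allFin n)
  A++B↭ : A ++ B ↭ allFin n
  A++B↭ = filter-++-filter-¬-↭ low? (allFin n)

  uA : Unique A
  uA = filter⁺ low? (allFin⁺ n)

  uB : Unique B
  uB = filter⁺ (¬? ∘ low?) (allFin⁺ n)

  A⇒low : ∀ {v} → v ∈ A → d v ≤ suc c
  A⇒low v∈ = proj₂ (∈-filter⁻ low? {xs = allFin n} v∈)

  A∩B : ∀ {v} → v ∈ A → v ∉ B
  A∩B v∈ v∈′ = proj₂ (∈-filter⁻ (¬? ∘ low?) {xs = allFin n} v∈′) (A⇒low v∈)

  A∪B : ∀ v → v ∈ A ⊎ v ∈ B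
  A∪B v = ∈-++⁻ A (∈-resp-↭ (↭-sym A++B↭) (∈-allFin v))

  ∣A∣+∣B∣ : length A + length B ≡ n
  ∣A∣+∣B∣ = trans (length-filter-¬ low? (allFin n)) (length-allFin n)

  -- This is `few` at i = c + 1, admissible because 2(c + 1) < n.
  ∣A∣≤c : length A ≤ c
  ∣A∣≤c = s≤s⁻¹ (few (suc c) ≤-refl (≤-trans (≤-reflexive arith) large) A uA A⇒low)
    where
    arith : suc (suc c + suc c) ≡ 2 * c + 3
    arith = solve 1 (λ c → con 2 :+ (c :+ (con 1 :+ c)) := con 2 :* c :+ con 3) refl c

  cliqueB : Clique C B
  cliqueB u∈ v∈ u≢v = highAdjacent u≢v (high u∈) (high v∈)
    where
    high : ∀ {v} → v ∈ B → suc c < d v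
    high v∈ = ≰⇒> (proj₂ (∈-filter⁻ (¬? ∘ low?) {xs = allFin n} v∈))

  ⊆nbrs⇒length≤degree : ∀ v {T} → Unique T → (∀ {w} → w ∈ T → Adj C v w) → length T ≤ d v
  ⊆nbrs⇒length≤degree v u nb = unique-⊆⇒length≤ u λ w∈ → ∈-filter⁺ (adj? C v) (∈-allFin _) (nb w∈)

  ∣B∣≤1+degree : ∀ {b} → b ∈ B → length B ≤ suc (d b)
  ∣B∣≤1+degree {b} b∈ = unique-⊆⇒length≤ uB sub
    where
    sub : ∀ {w} → w ∈ B → w ∈ b ∷ filter (adj? C b) (allFin n)
    sub {w} w∈ with w ≟ᶠ b
    ... | yes e = here e
    ... | no ≢ = there (∈-filter⁺ (adj? C b) (∈-allFin w) (cliqueB b∈ w∈ (≢-sym ≢)))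

  -- The neighbour x outside the clique makes up for b not being its own neighbour. This gain of one
  -- is what makes `common` work.
  ∣B∣≤degree : ∀ {b x} → b ∈ B → x ∈ A → Adj C b x → length B ≤ d b
  ∣B∣≤degree {b} {x} b∈ x∈ bx = s≤s⁻¹ (unique-⊆⇒length≤ (∉⇒Unique-∷ (A∩B x∈) uB) sub)
    where
    sub : ∀ {w} → w ∈ x ∷ B → w ∈ b ∷ filter (adj? C b) (allFin n)
    sub (here refl) = there (∈-filter⁺ (adj? C b) (∈-allFin x) bx)
    sub {w} (there w∈) with w ≟ᶠ b
    ... | yes e = here e
    ... | no ≢ = there (∈-filter⁺ (adj? C b) (∈-allFin w) (cliqueB b∈ w∈ (≢-sym ≢)))

  someNonNbr : ∀ {x} → x ∈ A → ∃[ b ] b ∈ B × ¬ Adj C x b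
  someNonNbr {x} x∈ with Any.any? (¬? ∘ adj? C x) B
  ... | yes some = find some
  ... | no none = contradiction (≤-trans ∣B∣≤d (A⇒low x∈)) (<⇒≱ many)
    where
    ∣B∣≤d : length B ≤ d x
    ∣B∣≤d = ⊆nbrs⇒length≤degree x uB λ {w} w∈ → decidable-stable (adj? C x w) λ ¬xw → none (lose w∈ ¬xw)
    many : suc c < length B
    many = +-cancelˡ-≤ (length A) (suc (suc c)) (length B) (begin
      length A + suc (suc c) ≤⟨ +-monoˡ-≤ (suc (suc c)) ∣A∣≤c ⟩
      c + suc (suc c)        ≤⟨ n≤1+n _ ⟩
      suc (c + suc (suc c))  ≡⟨ solve 1 (λ c → con 1 :+ (c :+ (con 2 :+ c)) := con 2 :* c :+ con 3) refl c ⟩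
      2 * c + 3              ≤⟨ large ⟩
      n                      ≡⟨ sym ∣A∣+∣B∣ ⟩
      length A + length B    ∎)
      where open ≤-Reasoning

  -- For a non-neighbour b of x in B, closedness gives d x + d b < ∣A∣ + ∣B∣, while d b ≥ ∣B∣ - 1 in
  -- the clique.
  degree≤∣A∣ : ∀ {x} → x ∈ A → d x ≤ length A
  degree≤∣A∣ {x} x∈ with someNonNbr x∈
  ... | b , b∈ , ¬xb = +-cancelʳ-≤ (length B) (d x) (length A) (begin
      d x + length B        ≤⟨ +-monoʳ-≤ (d x) (∣B∣≤1+degree b∈) ⟩
      d x + suc (d b)       ≡⟨ +-suc (d x) (d b) ⟩
      suc (d x + d b)       ≤⟨ closed x b (λ { refl → A∩B x∈ b∈ }) ¬xb ⟩
      n                     ≡⟨ sym ∣A∣+∣B∣ ⟩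
      length A + length B   ∎)
      where open ≤-Reasoning

  module Nonempty {x₀} (x₀∈ : x₀ ∈ A) where

    ∣A∣≡c : length A ≡ c
    ∣A∣≡c = ≤-antisym ∣A∣≤c (≤-trans (c≤deg x₀) (degree≤∣A∣ x₀∈))

    degree≤c : ∀ {x} → x ∈ A → d x ≤ c
    degree≤c x∈ = ≤-trans (degree≤∣A∣ x∈) ∣A∣≤c

    -- If y missed b, closedness would fail: d y ≥ c ≥ ∣A∣, and d b ≥ ∣B∣ thanks to x, so the degree
    -- sum reaches n.
    common : ∀ {x y b} → x ∈ A → y ∈ A → b ∈ B → Adj C x b → Adj C y b
    common {x} {y} {b} x∈ y∈ b∈ xb = decidable-stable (adj? C y b) λ ¬yb →
      <⇒≱ (closed y b (λ { refl → A∩B y∈ b∈ }) ¬yb)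
          (≤-trans (≤-reflexive (sym ∣A∣+∣B∣))
            (+-mono-≤ (≤-trans ∣A∣≤c (c≤deg y)) (∣B∣≤degree b∈ x∈ (adj-sym C xb))))

    X Y : List (Fin n)
    X = filter (adj? C x₀) B
    Y = filter (¬? ∘ adj? C x₀) B

    uX : Unique X
    uX = filter⁺ (adj? C x₀) uB

    X⇒B : ∀ {v} → v ∈ X → v ∈ B
    X⇒B v∈ = proj₁ (∈-filter⁻ (adj? C x₀) {xs = B} v∈)

    X⇒Adj : ∀ {x v} → x ∈ A → v ∈ X → Adj C x v
    X⇒Adj x∈ v∈ with ∈-filter⁻ (adj? C x₀) {xs = B} v∈
    ... | v∈B , x₀v = common x₀∈ x∈ v∈B x₀v

    Adj⇒A⊎X : ∀ {x v} → x ∈ A → Adj C x v → v ∈ A ⊎ v ∈ X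
    Adj⇒A⊎X {x} {v} x∈ xv with A∪B v
    ... | inj₁ v∈A = inj₁ v∈A
    ... | inj₂ v∈B = inj₂ (∈-filter⁺ (adj? C x₀) v∈B (common x∈ x₀∈ v∈B xv))

    ∣X∣≤c : length X ≤ c
    ∣X∣≤c = ≤-trans (⊆nbrs⇒length≤degree x₀ uX (X⇒Adj x₀∈)) (degree≤c x₀∈)

    -- The neighbours of x lie in N or X, so ∣N∣ + ∣X∣ ≥ d x ≥ c ≥ ∣A∣; hence x misses at most ∣X∣
    -- vertices of A, itself included.
    nonNbrs : ∀ {x T} → x ∈ A → Unique T → (∀ {y} → y ∈ T → y ∈ A × ¬ Adj C x y) → length T ≤ length X
    nonNbrs {x} {T} x∈ uT T⊆ = +-cancelˡ-≤ (length N) (length T) (length X) (begin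
      length N + length T                            ≤⟨ +-monoʳ-≤ (length N) (unique-⊆⇒length≤ uT
                                                          λ y∈ → ∈-filter⁺ (¬? ∘ adj? C x) (proj₁ (T⊆ y∈)) (proj₂ (T⊆ y∈))) ⟩
      length N + length (filter (¬? ∘ adj? C x) A)   ≡⟨ length-filter-¬ (adj? C x) A ⟩
      length A                                       ≤⟨ ∣A∣≤c ⟩
      c                                              ≤⟨ c≤deg x ⟩
      d x                                            ≤⟨ unique-⊆⇒length≤ (filter⁺ (adj? C x) (allFin⁺ n)) sub ⟩
      length (N ++ X)                                ≡⟨ length-++ N ⟩
      length N + length X                            ∎)
      where
      open ≤-Reasoning
      N : List (Fin n)
      N = filter (adj? C x) A
      sub : ∀ {v} → v ∈ filter (adj? C x) (allFin n) → v ∈ N ++ X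
      sub v∈ with proj₂ (∈-filter⁻ (adj? C x) {xs = allFin n} v∈)
      ... | xv with Adj⇒A⊎X x∈ xv
      ...   | inj₁ v∈A = ∈-++⁺ˡ (∈-filter⁺ (adj? C x) v∈A xv)
      ...   | inj₂ v∈X = ∈-++⁺ʳ N v∈X

    exceptional : Isolation C A X c → Exceptional C c
    exceptional nb = record
      { A = A ; X = X ; uniqueA = uA ; uniqueX = uX ; disjoint = λ v∈ v∈X → A∩B v∈ (X⇒B v∈X)
      ; sizeA = ∣A∣≡c ; degrees = degree≤c ; isolation = nb }

    -- The c neighbours in X already exhaust the degree of a vertex of A.
    independent : length X ≡ c → ∀ {u v} → u ∈ A → Adj C u v → v ∈ X
    independent ∣X∣≡c {u} {v} u∈ uv with Adj⇒A⊎X u∈ uv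
    ... | inj₂ v∈X = v∈X
    ... | inj₁ v∈A = contradiction (≤-trans too-many (degree≤c u∈)) (<⇒≱ (s≤s (≤-reflexive (sym ∣X∣≡c))))
      where
      too-many : suc (length X) ≤ d u
      too-many = ⊆nbrs⇒length≤degree u {v ∷ X} (∉⇒Unique-∷ (A∩B v∈A ∘ X⇒B) uX)
        λ { (here refl) → uv ; (there w∈) → X⇒Adj u∈ w∈ }

    B-split : X ++ Y ↭ B
    B-split = filter-++-filter-¬-↭ (adj? C x₀) B

    cycle : ∀ X′ → X′ ≡ X → 2 ≤ length X′ → length X′ < c → HamiltonCycle (Adj C)
    cycle (x ∷ X′) X≡ (s≤s 1≤) X<c
      -- Here r = ∣X∣ - 1: the bound of `nonNbrs` is then r + 1, and r paths fit into the r gaps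
      -- between consecutive vertices of X.
      with PathCover.pathCover C A uA (length X′)
             (λ x∈ u s → subst (_ ≤_) (cong length (sym X≡)) (nonNbrs x∈ u s)) 1≤ (subst (_ <_) (sym ∣A∣≡c) X<c)
    ... | Ps , le , p = clique∪paths⇒HamiltonCycle C (≤-trans (m≤n+m 3 (2 * c)) large) Ps {x} {X′} {Y} le cl
        (All.tabulate att) (↭-trans (++⁺ʳ _ p) (↭-trans (++⁺ˡ A perm) A++B↭))
      where
      perm : (x ∷ X′) ++ Y ↭ B
      perm = subst (λ Z → Z ++ Y ↭ B) (sym X≡) B-split
      cl : Clique C (x ∷ X′ ++ Y)
      cl u∈ v∈ = cliqueB (∈-resp-↭ perm u∈) (∈-resp-↭ perm v∈)
      inA : ∀ {P v} → P ∈ Ps → v ∈ Path.vertices P → v ∈ A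
      inA P∈ v∈ = ∈-resp-↭ p (∈-concatMap⁺ Path.vertices (lose P∈ v∈))
      att : ∀ {P} → P ∈ Ps → Attached C (x ∷ X′) P
      att {P} P∈ z z∈ = adj-sym C (X⇒Adj (inA P∈ (head∈ (Path.walk P))) z∈X) ,
                        adj-sym C (X⇒Adj (inA P∈ (last∈ (Path.walk P))) z∈X)
        where
        z∈X : z ∈ X
        z∈X = subst (z ∈_) X≡ z∈

    result : HamiltonCycle (Adj C) ⊎ Exceptional C c
    result with length X in eq
    -- x₀ is a non-neighbour of itself, so X is not empty.
    ... | zero = contradiction (nonNbrs x₀∈ ([] ∷ []) λ { (here refl) → x₀∈ , irrefl C x₀ }) (<⇒≱ (s≤s (≤-reflexive eq)))
    ... | suc zero = inj₂ (exceptional (inj₂ (eq , Adj⇒A⊎X)))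
    ... | suc (suc r) with suc (suc r) <? c
    ...   | yes lt = inj₁ (cycle X refl (subst (2 ≤_) (sym eq) (s≤s (s≤s z≤n))) (subst (_< c) (sym eq) lt))
    ...   | no ≮ = inj₂ (exceptional (inj₁ (∣X∣≡c , independent ∣X∣≡c)))
      where
      ∣X∣≡c : length X ≡ c
      ∣X∣≡c = ≤-antisym ∣X∣≤c (subst (c ≤_) (sym eq) (≮⇒≥ ≮))

  hamiltonCycle⊎exceptional : HamiltonCycle (Adj C) ⊎ Exceptional C c
  hamiltonCycle⊎exceptional = byA A refl
    where
    complete : ∀ bs → A ≡ [] → bs ≡ B → HamiltonCycle (Adj C)
    complete [] A≡ B≡ = contradiction (≤-trans (≤-trans (m≤n+m 3 (2 * c)) large)
      (≤-reflexive (trans (sym ∣A∣+∣B∣) (cong₂ (λ P Q → length P + length Q) A≡ (sym B≡))))) λ ()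
    complete (b ∷ bs) A≡ B≡ = clique∪paths⇒HamiltonCycle C (≤-trans (m≤n+m 3 (2 * c)) large) [] {b} {[]} {bs} z≤n
      (subst (Clique C) (sym B≡) cliqueB) [] (subst₂ (λ P Q → P ++ Q ↭ allFin n) A≡ (sym B≡) A++B↭)
    byA : ∀ A′ → A′ ≡ A → HamiltonCycle (Adj C) ⊎ Exceptional C c
    byA []       eq = inj₁ (complete B (sym eq) refl)
    byA (x ∷ xs) eq = Nonempty.result (subst (x ∈_) eq (here refl))

-- Counting edges

⟦_⟧ : {P : Set} → Dec P → ℕ
⟦ P? ⟧ = if does P? then 1 else 0

sum-mono : ∀ {n} {f g : Fin n → ℕ} → (∀ i → f i ≤ g i) → sum f ≤ sum g
sum-mono {zero}  le = z≤n
sum-mono {suc n} le = +-mono-≤ (le zero) (sum-mono (le ∘ suc))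

summand≤sum : ∀ {n} (f : Fin n → ℕ) i → f i ≤ sum f
summand≤sum f zero    = m≤m+n _ _
summand≤sum f (suc i) = ≤-trans (summand≤sum (f ∘ suc) i) (m≤n+m _ _)

sum-const : ∀ n {a} → sum {n} (λ _ → a) ≡ n * a
sum-const zero        = refl
sum-const (suc n) {a} = cong (a +_) (sum-const n)

sum-*ʳ : ∀ {n} (f : Fin n → ℕ) a → sum (λ i → f i * a) ≡ sum f * a
sum-*ʳ {zero}  f a = refl
sum-*ʳ {suc n} f a = trans (cong (f zero * a +_) (sum-*ʳ (f ∘ suc) a)) (sym (*-distribʳ-+ a (f zero) _))

sum-*ˡ : ∀ {n} a (f : Fin n → ℕ) → sum (λ i → a * f i) ≡ a * sum f
sum-*ˡ a f = trans (sum-cong-≗ (λ i → *-comm a (f i))) (trans (sum-*ʳ f a) (*-comm _ a))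

sum-+ : ∀ m {n} (f : Fin (m + n) → ℕ) → sum f ≡ sum (λ i → f (i ↑ˡ n)) + sum (λ j → f (m ↑ʳ j))
sum-+ zero    f = refl
sum-+ (suc m) f = trans (cong (f zero +_) (sum-+ m (f ∘ suc))) (sym (+-assoc (f zero) _ _))

length-filter-tabulate : ∀ {A : Set} {P : Pred A 0ℓ} (P? : Decidable P) {n} (f : Fin n → A) →
                         length (filter P? (tabulate f)) ≡ sum (λ i → ⟦ P? (f i) ⟧)
length-filter-tabulate P? {zero}  f = refl
length-filter-tabulate P? {suc n} f with P? (f zero)
... | yes _ = cong suc (length-filter-tabulate P? (f ∘ suc))
... | no _  = length-filter-tabulate P? (f ∘ suc)

length-filter-map : ∀ {A B : Set} {P : Pred B 0ℓ} (P? : Decidable P) (f : A → B) xs →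
                    length (filter P? (map f xs)) ≡ length (filter (P? ∘ f) xs)
length-filter-map P? f [] = refl
length-filter-map P? f (x ∷ xs) with P? (f x)
... | yes _ = cong suc (length-filter-map P? f xs)
... | no _  = length-filter-map P? f xs

length-filter-cartesianProduct : ∀ {A B : Set} {P : Pred (A × B) 0ℓ} (P? : Decidable P) {m} (f : Fin m → A) ys →
  length (filter P? (cartesianProduct (tabulate f) ys)) ≡ sum (λ i → length (filter (λ y → P? (f i , y)) ys))
length-filter-cartesianProduct P? {zero} f ys = refl
length-filter-cartesianProduct P? {suc m} f ys =
  trans (cong length (filter-++ P? (map (f zero ,_) ys) _))
 (trans (length-++ (filter P? (map (f zero ,_) ys)))
        (cong₂ _+_ (length-filter-map P? (f zero ,_) ys) (length-filter-cartesianProduct P? (f ∘ suc) ys)))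

degreeSum : ∀ {n} → Graph n → ℕ
degreeSum G = sum (λ u → sum (λ v → ⟦ adj? G u v ⟧))

degree≡sum : ∀ {n} (G : Graph n) u → degree G u ≡ sum (λ v → ⟦ adj? G u v ⟧)
degree≡sum G u = length-filter-tabulate (adj? G u) id

handshake : ∀ {n} (G : Graph n) → e G + e G ≡ degreeSum G
handshake {n} G = begin
  e G + e G                                                   ≡⟨ cong₂ _+_ e≡ (trans e≡ (∑-comm up)) ⟩
  sum (λ u → sum (up u)) + sum (λ u → sum (λ v → up v u))     ≡⟨ ∑-distrib-+ (λ u → sum (up u)) _ ⟨
  sum (λ u → sum (up u) + sum (λ v → up v u))                 ≡⟨ sum-cong-≗ (λ u → sym (∑-distrib-+ (up u) _)) ⟩
  sum (λ u → sum (λ v → up u v + up v u))                     ≡⟨ sum-cong-≗ (λ u → sum-cong-≗ (orient u)) ⟩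
  degreeSum G                                                 ∎
  where
  open ≡-Reasoning
  up : Fin n → Fin n → ℕ
  up u v = ⟦ (u <ᶠ? v) ×-dec adj? G u v ⟧
  e≡ : e G ≡ sum (λ u → sum (up u))
  e≡ = trans (length-filter-cartesianProduct (λ (u , v) → (u <ᶠ? v) ×-dec adj? G u v) id (allFin n))
             (sum-cong-≗ (λ u → length-filter-tabulate (λ v → (u <ᶠ? v) ×-dec adj? G u v) id))
  orient : ∀ u v → up u v + up v u ≡ ⟦ adj? G u v ⟧
  orient u v = split (u <ᶠ? v) (v <ᶠ? u) (adj? G u v) (adj? G v u)
    where
    split : (u<v? : Dec (u <ᶠ v)) (v<u? : Dec (v <ᶠ u)) (uv? : Dec (Adj G u v)) (vu? : Dec (Adj G v u)) →
            ⟦ u<v? ×-dec uv? ⟧ + ⟦ v<u? ×-dec vu? ⟧ ≡ ⟦ uv? ⟧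
    split (yes u<v) (yes v<u) _ _         = contradiction v<u (<⇒≯ u<v)
    split (yes _) (no _) (yes _) _        = refl
    split (yes _) (no _) (no _)  _        = refl
    split (no _) (yes _) (yes _) (yes _)  = refl
    split (no _) (yes _) (no _) (no _)    = refl
    split (no _) (yes _) (yes uv) (no ¬vu) = contradiction (adj-sym G uv) ¬vu
    split (no _) (yes _) (no ¬uv) (yes vu) = contradiction (adj-sym G vu) ¬uv
    split (no _) (no _) (no _) _          = refl
    split (no ¬u<v) (no ¬v<u) (yes uv) _ with <ᶠ-cmp u v
    ... | tri< u<v _ _  = contradiction u<v ¬u<v
    ... | tri≈ _ refl _ = contradiction uv (irrefl G u)
    ... | tri> _ _ v<u  = contradiction v<u ¬v<u

e<⇒degreeSum< : ∀ {m n} (G : Graph m) (H : Graph n) → e G < e H → degreeSum G < degreeSum H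
e<⇒degreeSum< G H lt = subst₂ _<_ (handshake G) (handshake H) (+-mono-< lt lt)

-- The degree sum s(s - 1) with the subtraction moved across; only the lower bound is needed to
-- estimate H.
degreeSum-K : ∀ s → s * s ≤ degreeSum (K s) + s
degreeSum-K s = begin
  s * s                                                 ≡⟨ cong (s *_) (*-identityʳ s) ⟨
  s * (s * 1)                                           ≡⟨ sum-const s ⟨
  sum {s} (λ _ → s * 1)                                 ≡⟨ sum-cong-≗ {s} (λ u → sym (sum-const s)) ⟩
  sum {s} (λ u → sum {s} (λ v → 1))                     ≡⟨ sum-cong-≗ {s} (λ u → sum-cong-≗ {s} (one u)) ⟩
  sum {s} (λ u → sum {s} (λ v → ne u v + eq u v))       ≡⟨ sum-cong-≗ {s} (λ u → ∑-distrib-+ {s} (ne u) (eq u)) ⟩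
  sum {s} (λ u → sum (ne u) + sum (eq u))               ≡⟨ ∑-distrib-+ {s} (λ u → sum (ne u)) (λ u → sum (eq u)) ⟩
  degreeSum (K s) + sum (λ u → sum (eq u))              ≤⟨ +-monoʳ-≤ (degreeSum (K s)) (sum-mono diag) ⟩
  degreeSum (K s) + sum {s} (λ _ → 1)                   ≡⟨ cong (degreeSum (K s) +_) (trans (sum-const s) (*-identityʳ s)) ⟩
  degreeSum (K s) + s                                   ∎
  where
  open ≤-Reasoning
  ne eq : Fin s → Fin s → ℕ
  ne u v = ⟦ ¬? (u ≟ᶠ v) ⟧
  eq u v = ⟦ u ≟ᶠ v ⟧
  one : ∀ u v → 1 ≡ ne u v + eq u v
  one u v with u ≟ᶠ v
  ... | yes _ = refl
  ... | no _  = refl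
  diag : ∀ u → sum (eq u) ≤ 1
  diag u = subst (_≤ 1) (length-filter-tabulate (u ≟ᶠ_) id)
    (unique-⊆⇒length≤ {ys = [ u ]} (filter⁺ (u ≟ᶠ_) (allFin⁺ s))
      λ v∈ → here (sym (proj₂ (∈-filter⁻ (u ≟ᶠ_) {xs = allFin s} v∈))))

degreeSum-sumGraph : ∀ {m n} (G : Graph m) (H : Graph n) {C : Set} (C? : Dec C) →
  degreeSum (sumGraph G H C?) ≡ degreeSum G + degreeSum H + 2 * (m * n * ⟦ C? ⟧)
degreeSum-sumGraph {m} {n} G H C? = begin
  degreeSum (sumGraph G H C?)
    ≡⟨ sum-+ m _ ⟩
  sum (λ i → row (i ↑ˡ n)) + sum (λ j → row (m ↑ʳ j))
    ≡⟨ cong₂ _+_ (sum-cong-≗ rowˡ) (sum-cong-≗ rowʳ) ⟩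
  sum (λ i → sum (λ i′ → ⟦ adj? G i i′ ⟧) + n * c) + sum (λ j → m * c + sum (λ j′ → ⟦ adj? H j j′ ⟧))
    ≡⟨ cong₂ _+_ (trans (∑-distrib-+ {m} _ (λ _ → n * c)) (cong (degreeSum G +_) (sum-const m)))
                 (trans (∑-distrib-+ {n} (λ _ → m * c) _) (cong (_+ degreeSum H) (sum-const n))) ⟩
  (degreeSum G + m * (n * c)) + (n * (m * c) + degreeSum H)
    ≡⟨ solve 5 (λ g h m n c → (g :+ m :* (n :* c)) :+ (n :* (m :* c) :+ h) := g :+ h :+ con 2 :* (m :* n :* c))
         refl (degreeSum G) (degreeSum H) m n c ⟩
  degreeSum G + degreeSum H + 2 * (m * n * c) ∎
  where
  open ≡-Reasoning
  c : ℕ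
  c = ⟦ C? ⟧
  row : Fin (m + n) → ℕ
  row u = sum (λ v → ⟦ adj? (sumGraph G H C?) u v ⟧)
  rowˡ : ∀ i → row (i ↑ˡ n) ≡ sum (λ i′ → ⟦ adj? G i i′ ⟧) + n * c
  rowˡ i = trans (sum-+ m _) (cong₂ _+_ (sum-cong-≗ ll) (trans (sum-cong-≗ lr) (sum-const n)))
    where
    ll : ∀ i′ → ⟦ adj? (sumGraph G H C?) (i ↑ˡ n) (i′ ↑ˡ n) ⟧ ≡ ⟦ adj? G i i′ ⟧
    ll i′ rewrite splitAt-↑ˡ m i n | splitAt-↑ˡ m i′ n = refl
    lr : ∀ j → ⟦ adj? (sumGraph G H C?) (i ↑ˡ n) (m ↑ʳ j) ⟧ ≡ c
    lr j rewrite splitAt-↑ˡ m i n | splitAt-↑ʳ m n j = refl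
  rowʳ : ∀ j → row (m ↑ʳ j) ≡ m * c + sum (λ j′ → ⟦ adj? H j j′ ⟧)
  rowʳ j = trans (sum-+ m _) (cong₂ _+_ (trans (sum-cong-≗ rl) (sum-const m)) (sum-cong-≗ rr))
    where
    rl : ∀ i → ⟦ adj? (sumGraph G H C?) (m ↑ʳ j) (i ↑ˡ n) ⟧ ≡ c
    rl i rewrite splitAt-↑ʳ m n j | splitAt-↑ˡ m i n = refl
    rr : ∀ j′ → ⟦ adj? (sumGraph G H C?) (m ↑ʳ j) (m ↑ʳ j′) ⟧ ≡ ⟦ adj? H j j′ ⟧
    rr j′ rewrite splitAt-↑ʳ m n j | splitAt-↑ʳ m n j′ = refl

-- H is a clique on m vertices with t further vertices of degree d, so its degree sum is m(m - 1) +
-- 2dt.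
degreeSum-H : ∀ n k d {m t} → d + ((n + k) ∸ 2 * d) ≡ m → d ∸ k ≡ t →
              m * m + 2 * (d * t) ≤ degreeSum H[ n , k , d ] + m
degreeSum-H n k d {_} {t} refl refl = begin
  m * m + 2 * (d * t)
    ≡⟨ solve 3 (λ d x t → (d :+ x) :* (d :+ x) :+ con 2 :* (d :* t)
                       := d :* d :+ x :* x :+ con 2 :* (d :* (x :+ t) :* con 1)) refl d x t ⟩
  d * d + x * x + cross
    ≤⟨ +-monoˡ-≤ cross (+-mono-≤ (degreeSum-K d) (degreeSum-K x)) ⟩
  (degreeSum (K d) + d) + (degreeSum (K x) + x) + cross
    ≤⟨ +-monoˡ-≤ cross (+-monoʳ-≤ (degreeSum (K d) + d) (+-monoˡ-≤ x
         (≤-trans (≤-trans (m≤m+n _ _) (m≤m+n _ _)) (≤-reflexive (sym (degreeSum-sumGraph (K x) (I t) _)))))) ⟩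
  (degreeSum (K d) + d) + (degreeSum (K x ∪ I t) + x) + cross
    ≡⟨ solve 5 (λ a d b x c → (a :+ d) :+ (b :+ x) :+ c := a :+ b :+ c :+ (d :+ x)) refl
         (degreeSum (K d)) d (degreeSum (K x ∪ I t)) x cross ⟩
  degreeSum (K d) + degreeSum (K x ∪ I t) + cross + m
    ≡⟨ cong (_+ m) (degreeSum-sumGraph (K d) (K x ∪ I t) _) ⟨
  degreeSum H[ n , k , d ] + m ∎
  where
  open ≤-Reasoning
  x m cross : ℕ
  x = (n + k) ∸ 2 * d
  m = d + x
  cross = 2 * (d * (x + t) * 1)

-- Ordered adjacent pairs outside T number at most m(m - 1); every other one has its first or its
-- second end in T, which gives at most ∣T∣D each. The summand m is spread over the diagonal as the
-- indicator `a`, so that the estimate can be checked at each pair separately.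
degreeSum-≤ : ∀ {n} (G : Graph n) T {m D} → Unique T → (∀ {v} → v ∈ T → degree G v ≤ D) →
              m + length T ≡ n → degreeSum G + m ≤ m * m + 2 * (length T * D)
degreeSum-≤ {n} G T {m} {D} uT low m+T≡n = begin
  degreeSum G + m
    ≡⟨ cong (degreeSum G +_) (sym sum-a) ⟩
  degreeSum G + sum a
    ≤⟨ +-monoʳ-≤ (degreeSum G) (sum-mono (λ u → ≤-trans (self u) (summand≤sum (λ v → ⟦ u ≟ᶠ v ⟧ * a u) u))) ⟩
  degreeSum G + sum (λ u → sum (λ v → ⟦ u ≟ᶠ v ⟧ * a u))
    ≡⟨ ∑-distrib-+ (λ u → sum (λ v → ⟦ adj? G u v ⟧)) _ ⟨
  sum (λ u → sum (λ v → ⟦ adj? G u v ⟧) + sum (λ v → ⟦ u ≟ᶠ v ⟧ * a u))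
    ≡⟨ sum-cong-≗ (λ u → sym (∑-distrib-+ (λ v → ⟦ adj? G u v ⟧) _)) ⟩
  sum (λ u → sum (λ v → ⟦ adj? G u v ⟧ + ⟦ u ≟ᶠ v ⟧ * a u))
    ≤⟨ sum-mono (λ u → sum-mono (pointwise u)) ⟩
  sum (λ u → sum (λ v → a u * a v + (tadj u v + tadj v u)))
    ≡⟨ sum-cong-≗ (λ u → trans (∑-distrib-+ (λ v → a u * a v) _)
         (cong (sum (λ v → a u * a v) +_) (∑-distrib-+ (tadj u) _))) ⟩
  sum (λ u → sum (λ v → a u * a v) + (sum (tadj u) + sum (λ v → tadj v u)))
    ≡⟨ trans (∑-distrib-+ (λ u → sum (λ v → a u * a v)) _)
         (cong (sum (λ u → sum (λ v → a u * a v)) +_) (∑-distrib-+ (λ u → sum (tadj u)) _)) ⟩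
  sum (λ u → sum (λ v → a u * a v)) + (sum (λ u → sum (tadj u)) + sum (λ u → sum (λ v → tadj v u)))
    ≡⟨ cong₂ (λ p q → p + (sum (λ u → sum (tadj u)) + q)) aa (sym (∑-comm tadj)) ⟩
  m * m + (sum (λ u → sum (tadj u)) + sum (λ u → sum (tadj u)))
    ≤⟨ +-monoʳ-≤ (m * m) (+-mono-≤ tadj≤ tadj≤) ⟩
  m * m + (length T * D + length T * D)
    ≡⟨ cong (λ z → m * m + (length T * D + z)) (sym (+-identityʳ _)) ⟩
  m * m + 2 * (length T * D) ∎
  where
  open ≤-Reasoning
  open DecMembership (_≟ᶠ_ {n}) using (_∈?_)
  a t : Fin n → ℕ
  a u = ⟦ ¬? (u ∈? T) ⟧
  t u = ⟦ u ∈? T ⟧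
  tadj : Fin n → Fin n → ℕ
  tadj u v = t u * ⟦ adj? G u v ⟧
  sum-t : sum t ≡ length T
  sum-t = trans (sym (length-filter-tabulate (_∈? T) id)) (≤-antisym
    (unique-⊆⇒length≤ (filter⁺ (_∈? T) (allFin⁺ n)) λ v∈ → proj₂ (∈-filter⁻ (_∈? T) {xs = allFin n} v∈))
    (unique-⊆⇒length≤ uT λ v∈ → ∈-filter⁺ (_∈? T) (∈-allFin _) v∈))
  sum-a : sum a ≡ m
  sum-a = +-cancelʳ-≡ (length T) (sum a) m (trans (trans (+-comm (sum a) (length T))
    (trans (cong₂ _+_ (sym (trans (length-filter-tabulate (_∈? T) id) sum-t)) (sym (length-filter-tabulate (¬? ∘ (_∈? T)) id)))
    (trans (length-filter-¬ (_∈? T) (allFin n)) (length-allFin n)))) (sym m+T≡n))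
  aa : sum (λ u → sum (λ v → a u * a v)) ≡ m * m
  aa = trans (sum-cong-≗ (λ u → sum-*ˡ (a u) a)) (trans (sum-*ʳ a (sum a)) (cong₂ _*_ sum-a sum-a))
  tadj≤ : sum (λ u → sum (tadj u)) ≤ length T * D
  tadj≤ = begin
    sum (λ u → sum (tadj u))   ≡⟨ sum-cong-≗ {n} (λ u → trans (sum-*ˡ (t u) (λ v → ⟦ adj? G u v ⟧)) (cong (t u *_) (sym (degree≡sum G u)))) ⟩
    sum (λ u → t u * degree G u) ≤⟨ sum-mono bound ⟩
    sum (λ u → t u * D)        ≡⟨ sum-*ʳ t D ⟩
    sum t * D                  ≡⟨ cong (_* D) sum-t ⟩
    length T * D               ∎
    where
    bound : ∀ u → t u * degree G u ≤ t u * D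
    bound u with u ∈? T
    ... | yes u∈ = +-monoˡ-≤ 0 (low u∈)
    ... | no _   = z≤n
  self : ∀ u → a u ≤ ⟦ u ≟ᶠ u ⟧ * a u
  self u with u ≟ᶠ u
  ... | yes _ = m≤m+n _ _
  ... | no ≢  = contradiction refl ≢
  pointwise : ∀ u v → ⟦ adj? G u v ⟧ + ⟦ u ≟ᶠ v ⟧ * a u ≤ a u * a v + (tadj u v + tadj v u)
  pointwise u v with adj? G u v | adj? G v u | u ≟ᶠ v
  ... | yes uv | no ¬vu | _ = contradiction (adj-sym G uv) ¬vu
  ... | no ¬uv | yes vu | _ = contradiction (adj-sym G vu) ¬uv
  ... | yes uv | _ | yes refl = contradiction uv (irrefl G u)
  ... | no _ | no _ | no _ = z≤n
  ... | no _ | no _ | yes refl with u ∈? T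
  ...   | yes _ = z≤n
  ...   | no _  = ≤-refl
  pointwise u v | yes uv | yes vu | no _ with u ∈? T | v ∈? T
  ...   | yes _ | _     = s≤s z≤n
  ...   | no _  | yes _ = s≤s z≤n
  ...   | no _  | no _  = s≤s z≤n

private
  -- After cancellation the claim is q(4C + 2k + 2q + 1) ≤ q(2m + q), and the two hypotheses add up
  -- to 4C + 3k + q + 1 ≤ 2m.
  excess : ∀ m C q k → 3 * (C + k) ≤ m → C + q < m →
           m * m + 2 * ((C + q) * (C + q + k)) + q ≤ (m + q) * (m + q) + 2 * ((C + k) * C)
  excess m C q k 3≤m i<m = begin
    m * m + 2 * ((C + q) * (C + q + k)) + q
      ≡⟨ solve 4 (λ m C q k → m :* m :+ con 2 :* ((C :+ q) :* (C :+ q :+ k)) :+ q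
           := m :* m :+ con 2 :* ((C :+ k) :* C) :+ q :* (con 4 :* C :+ con 2 :* k :+ con 2 :* q :+ con 1)) refl m C q k ⟩
    base + q * (4 * C + 2 * k + 2 * q + 1)
      ≤⟨ +-monoʳ-≤ base (*-monoʳ-≤ q (≤-trans (≤-trans (m≤m+n _ k) (≤-reflexive
           (solve 3 (λ C q k → con 4 :* C :+ con 2 :* k :+ con 2 :* q :+ con 1 :+ k
              := con 3 :* (C :+ k) :+ (con 1 :+ (C :+ q)) :+ q) refl C q k)))
           (+-monoˡ-≤ q (+-mono-≤ 3≤m i<m)))) ⟩
    base + q * (m + m + q)
      ≡⟨ solve 4 (λ m C q k → m :* m :+ con 2 :* ((C :+ k) :* C) :+ q :* (m :+ m :+ q)
           := (m :+ q) :* (m :+ q) :+ con 2 :* ((C :+ k) :* C)) refl m C q k ⟩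
    (m + q) * (m + q) + 2 * ((C + k) * C) ∎
    where
    open ≤-Reasoning
    base : ℕ
    base = m * m + 2 * ((C + k) * C)

-- With i = (c + 1) + q and n = m + i, the degree sum of H[ n , k , c + 1 + k ] exceeds
-- the bound m² + 2i(i + k) − m on that of G by q(2m + q) − q(4(c + 1) + 2k + 2q + 1) ≥ 0.
few-lowDegree : ∀ {n} (G : Graph n) k c i T → c < i → i + i < n → 6 * (suc c + k) ≤ n →
  e H[ n , k , suc c + k ] < e G → Unique T → length T ≡ i → ¬ (∀ {v} → v ∈ T → degree G v ≤ i + k)
few-lowDegree {n} G k c i T c<i 2i<n large eH<eG uT |T|≡i low =
  go (i ∸ C) (n ∸ i) (sym (m+[n∸m]≡n c<i)) (sym (m∸n+n≡m (≤-trans (m≤m+n i i) (<⇒≤ 2i<n))))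
  where
  C : ℕ
  C = suc c
  go : ∀ q m → i ≡ C + q → n ≡ m + i → ⊥
  go q m i≡ n≡ = <⇒≱ lower upper
    where
    d : ℕ
    d = C + k
    i<m : i < m
    i<m = +-cancelʳ-< i i m (subst (i + i <_) n≡ 2i<n)
    -- Origin of the factor 6 in the threshold: `excess` wants 3d ≤ m, and m is more than half of n.
    3d≤m : 3 * d ≤ m
    3d≤m = *-cancelˡ-≤ 2 (begin
      2 * (3 * d)   ≡⟨ solve 1 (λ d → con 2 :* (con 3 :* d) := con 6 :* d) refl d ⟩
      6 * d         ≤⟨ large ⟩
      n             ≡⟨ n≡ ⟩
      m + i         ≤⟨ +-monoʳ-≤ m (<⇒≤ i<m) ⟩
      m + m         ≡⟨ cong (m +_) (sym (+-identityʳ m)) ⟩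
      2 * m         ∎)
      where open ≤-Reasoning
    upper : degreeSum G + m ≤ m * m + 2 * (i * (i + k))
    upper = subst (λ l → degreeSum G + m ≤ m * m + 2 * (l * (i + k))) |T|≡i
              (degreeSum-≤ G T uT low (trans (cong (m +_) |T|≡i) (sym n≡)))
    d≤m+q : d ≤ m + q
    d≤m+q = ≤-trans (≤-trans (m≤m+n d (2 * d)) 3d≤m) (m≤m+n m q)
    clique : d + ((n + k) ∸ 2 * d) ≡ m + q
    clique = trans (cong (λ z → d + (z ∸ 2 * d)) n+k≡) (trans (cong (d +_) (m+n∸m≡n (2 * d) _)) (m+[n∸m]≡n d≤m+q))
      where
      open ≡-Reasoning
      n+k≡ : n + k ≡ 2 * d + ((m + q) ∸ d)
      n+k≡ = begin
        n + k                       ≡⟨ cong (_+ k) (trans n≡ (cong (m +_) i≡)) ⟩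
        m + (C + q) + k             ≡⟨ solve 4 (λ m C q k → m :+ (C :+ q) :+ k := (C :+ k) :+ (m :+ q)) refl m C q k ⟩
        d + (m + q)                 ≡⟨ cong (d +_) (sym (m+[n∸m]≡n d≤m+q)) ⟩
        d + (d + ((m + q) ∸ d))     ≡⟨ sym (+-assoc d d _) ⟩
        d + d + ((m + q) ∸ d)       ≡⟨ cong (λ z → d + z + ((m + q) ∸ d)) (sym (+-identityʳ d)) ⟩
        2 * d + ((m + q) ∸ d)       ∎
    lower : m * m + 2 * (i * (i + k)) < degreeSum G + m
    lower = +-cancelʳ-< q _ _ (begin
      suc (m * m + 2 * (i * (i + k)) + q)                 ≡⟨ cong (λ z → suc (m * m + 2 * (z * (z + k)) + q)) i≡ ⟩
      suc (m * m + 2 * ((C + q) * (C + q + k)) + q)       ≤⟨ s≤s (excess m C q k 3d≤m (subst (_< m) i≡ i<m)) ⟩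
      suc ((m + q) * (m + q) + 2 * (d * C))               ≤⟨ s≤s (degreeSum-H n k d clique (m+n∸n≡m C k)) ⟩
      suc (degreeSum H[ n , k , d ]) + (m + q)            ≤⟨ +-monoˡ-≤ (m + q) (e<⇒degreeSum< H[ n , k , d ] G eH<eG) ⟩
      degreeSum G + (m + q)                               ≡⟨ sym (+-assoc _ m q) ⟩
      degreeSum G + m + q                                 ∎)
      where open ≤-Reasoning

-- Induced subgraphs and embeddings

lookup-injective : ∀ {A : Set} {xs : List A} → Unique xs → ∀ {i j} → lookup xs i ≡ lookup xs j → i ≡ j
lookup-injective (_ ∷ _)  {zero}  {zero}  _  = refl
lookup-injective (x∉ ∷ _) {zero}  {suc j} eq = contradiction eq (All.lookup x∉ (∈-lookup j))
lookup-injective (x∉ ∷ _) {suc i} {zero}  eq = contradiction (sym eq) (All.lookup x∉ (∈-lookup i))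
lookup-injective (_ ∷ u)  {suc i} {suc j} eq = cong suc (lookup-injective u eq)

module _ {n} (S : Subset n) where

  unique-members : Unique (members S)
  unique-members = filter⁺ (_∈ˢ? S) (allFin⁺ n)

  ∈-members⁺ : ∀ {v} → v ∈ˢ S → v ∈ members S
  ∈-members⁺ v∈ = ∈-filter⁺ (_∈ˢ? S) (∈-allFin _) v∈

  ∈-members⁻ : ∀ {v} → v ∈ members S → v ∈ˢ S
  ∈-members⁻ v∈ = proj₂ (∈-filter⁻ (_∈ˢ? S) {xs = allFin n} v∈)

length-members : ∀ {n} (S : Subset n) → length (members S) ≡ ∣ S ∣
length-members {n} S = trans (length-filter-tabulate (_∈ˢ? S) id) (go S)
  where
  go : ∀ {n} (S : Subset n) → sum (λ v → ⟦ v ∈ˢ? S ⟧) ≡ ∣ S ∣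
  go Vec.[]            = refl
  go (inside  Vec.∷ S) = cong suc (go S)
  go (outside Vec.∷ S) = go S

module _ {m n} (G : Graph m) (H : Graph n) {C : Set} (C? : Dec C) where

  sumGraph-ˡˡ : ∀ {u v} → Adj G u v → Adj (sumGraph G H C?) (u ↑ˡ n) (v ↑ˡ n)
  sumGraph-ˡˡ {u} {v} uv rewrite splitAt-↑ˡ m u n | splitAt-↑ˡ m v n = uv

  sumGraph-ʳʳ : ∀ {u v} → Adj H u v → Adj (sumGraph G H C?) (m ↑ʳ u) (m ↑ʳ v)
  sumGraph-ʳʳ {u} {v} uv rewrite splitAt-↑ʳ m n u | splitAt-↑ʳ m n v = uv

  sumGraph-ˡʳ : ∀ {u v} → C → Adj (sumGraph G H C?) (u ↑ˡ n) (m ↑ʳ v)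
  sumGraph-ˡʳ {u} {v} c rewrite splitAt-↑ˡ m u n | splitAt-↑ʳ m n v = c

  sumGraph-ʳˡ : ∀ {u v} → C → Adj (sumGraph G H C?) (m ↑ʳ v) (u ↑ˡ n)
  sumGraph-ʳˡ {u} {v} c rewrite splitAt-↑ˡ m u n | splitAt-↑ʳ m n v = c

-- X goes to the joined clique, A to the block Y, and the remaining vertices R to the other clique.
-- The target omits only the pairs between R and A, excluded by `nbrs`, and pairs inside Y, handled
-- by `inner`. Y is a family so that one proof serves I (for H) and K (for L).
module Embedding {n} (G : Graph n) (X A : List (Fin n)) (uX : Unique X) (uA : Unique A)
  (disjoint : ∀ {v} → v ∈ A → v ∉ X) (Y : ∀ a → Graph a)
  (nbrs : ∀ {u v} → u ∈ A → Adj G u v → v ∈ A ⊎ v ∈ X)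
  (inner : ∀ {u v} (u∈ : u ∈ A) (v∈ : v ∈ A) → Adj G u v → Adj (Y (length A)) (index u∈) (index v∈)) where

  open DecMembership (_≟ᶠ_ {n}) using (_∈?_)

  private
    R? : Decidable (λ v → v ∉ X × v ∉ A)
    R? v = ¬? (v ∈? X) ×-dec ¬? (v ∈? A)

    R : List (Fin n)
    R = filter R? (allFin n)

    R⁻ : ∀ {v} → v ∈ R → v ∉ X × v ∉ A
    R⁻ v∈ = proj₂ (∈-filter⁻ R? {xs = allFin n} v∈)

    Place : Fin n → Set
    Place v = v ∈ X ⊎ (v ∈ R ⊎ v ∈ A)

    place : ∀ v → Place v
    place v with v ∈? X | v ∈? A
    ... | yes v∈X | _       = inj₁ v∈X
    ... | no _    | yes v∈A = inj₂ (inj₂ v∈A)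
    ... | no v∉X  | no v∉A  = inj₂ (inj₁ (∈-filter⁺ R? (∈-allFin v) (v∉X , v∉A)))

    x r a : ℕ
    x = length X
    r = length R
    a = length A

    code : ∀ {v} → Place v → Fin (x + (r + a))
    code (inj₁ p)        = index p ↑ˡ (r + a)
    code (inj₂ (inj₁ p)) = x ↑ʳ (index p ↑ˡ a)
    code (inj₂ (inj₂ p)) = x ↑ʳ (r ↑ʳ index p)

    decode : Fin (x + (r + a)) → Fin n
    decode = [ lookup X , [ lookup R , lookup A ]′ ∘ splitAt r ]′ ∘ splitAt x

    decode-code : ∀ {v} (p : Place v) → decode (code p) ≡ v
    decode-code (inj₁ p) rewrite splitAt-↑ˡ x (index p) (r + a) = sym (lookup-index p)
    decode-code (inj₂ (inj₁ p)) rewrite splitAt-↑ʳ x (r + a) (index p ↑ˡ a) | splitAt-↑ˡ r (index p) a = sym (lookup-index p)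
    decode-code (inj₂ (inj₂ p)) rewrite splitAt-↑ʳ x (r + a) (r ↑ʳ index p) | splitAt-↑ʳ r a (index p) = sym (lookup-index p)

    index-≢ : ∀ {xs : List (Fin n)} {u v} (p : u ∈ xs) (q : v ∈ xs) → u ≢ v → index p ≢ index q
    index-≢ {xs} p q u≢v eq = u≢v (trans (lookup-index p) (trans (cong (lookup xs) eq) (sym (lookup-index q))))

    Adj⇒≢ : ∀ {u v} → Adj G u v → u ≢ v
    Adj⇒≢ uv refl = irrefl G _ uv

    R≁A : ∀ {u v} → u ∈ A → v ∈ R → ¬ Adj G u v
    R≁A u∈ v∈ uv with R⁻ v∈ | nbrs u∈ uv
    ... | _ , v∉A | inj₁ v∈A = v∉A v∈A
    ... | v∉X , _ | inj₂ v∈X = v∉X v∈X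

    code-adj : ∀ {u v} (p : Place u) (q : Place v) → Adj G u v → Adj (K x ∨ (K r ∪ Y a)) (code p) (code q)
    code-adj (inj₁ p) (inj₁ q) uv = sumGraph-ˡˡ (K x) (K r ∪ Y a) ⊤-dec (index-≢ p q (Adj⇒≢ uv))
    code-adj (inj₁ p) (inj₂ (inj₁ q)) uv = sumGraph-ˡʳ (K x) (K r ∪ Y a) ⊤-dec _
    code-adj (inj₁ p) (inj₂ (inj₂ q)) uv = sumGraph-ˡʳ (K x) (K r ∪ Y a) ⊤-dec _
    code-adj (inj₂ (inj₁ p)) (inj₁ q) uv = sumGraph-ʳˡ (K x) (K r ∪ Y a) ⊤-dec _
    code-adj (inj₂ (inj₂ p)) (inj₁ q) uv = sumGraph-ʳˡ (K x) (K r ∪ Y a) ⊤-dec _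
    code-adj (inj₂ (inj₁ p)) (inj₂ (inj₁ q)) uv =
      sumGraph-ʳʳ (K x) (K r ∪ Y a) ⊤-dec (sumGraph-ˡˡ (K r) (Y a) ⊥-dec (index-≢ p q (Adj⇒≢ uv)))
    code-adj (inj₂ (inj₂ p)) (inj₂ (inj₂ q)) uv =
      sumGraph-ʳʳ (K x) (K r ∪ Y a) ⊤-dec (sumGraph-ʳʳ (K r) (Y a) ⊥-dec (inner p q uv))
    code-adj (inj₂ (inj₁ p)) (inj₂ (inj₂ q)) uv = ⊥-elim (R≁A q p (adj-sym G uv))
    code-adj (inj₂ (inj₂ p)) (inj₂ (inj₁ q)) uv = ⊥-elim (R≁A p q uv)

    length-rest : x + (r + a) ≡ n
    length-rest = trans (sym (trans (length-++ X) (cong (x +_) (length-++ R))))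
      (trans (≤-antisym (unique-⊆⇒length≤ (++⁺ uX (++⁺ uR uA R∩A) X∩) λ _ → ∈-allFin _)
                        (unique-⊆⇒length≤ (allFin⁺ n) λ {v} _ → join (place v)))
             (length-allFin n))
      where
      uR : Unique R
      uR = filter⁺ R? (allFin⁺ n)
      R∩A : ∀ {v} → ¬ (v ∈ R × v ∈ A)
      R∩A (v∈R , v∈A) = proj₂ (R⁻ v∈R) v∈A
      X∩ : ∀ {v} → ¬ (v ∈ X × v ∈ R ++ A)
      X∩ (v∈X , v∈) with ∈-++⁻ R v∈
      ... | inj₁ v∈R = proj₁ (R⁻ v∈R) v∈X
      ... | inj₂ v∈A = disjoint v∈A v∈X
      join : ∀ {v} → Place v → v ∈ X ++ R ++ A
      join (inj₁ p)        = ∈-++⁺ˡ p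
      join (inj₂ (inj₁ p)) = ∈-++⁺ʳ X (∈-++⁺ˡ p)
      join (inj₂ (inj₂ p)) = ∈-++⁺ʳ X (∈-++⁺ʳ R p)

  -- The blocks exhaust the n vertices, so the size of R is forced by the other two and need not be
  -- computed; r′ may be the truncated difference occurring in H or L.
  embed : ∀ {x′ r′ a′} → length X ≡ x′ → length A ≡ a′ → x′ + (r′ + a′) ≡ n → G ⊑ K x′ ∨ (K r′ ∪ Y a′)
  embed {r′ = r′} refl refl sizes = subst (λ z → G ⊑ K x ∨ (K z ∪ Y a))
    (+-cancelʳ-≡ a r r′ (+-cancelˡ-≡ x _ _ (trans length-rest (sym sizes))))
    ( code ∘ place
    , (λ {u} {v} eq → trans (sym (decode-code (place u))) (trans (cong decode eq) (decode-code (place v))))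
    , λ {u} {v} → code-adj (place u) (place v))

module _ {n} (G : Graph n) (S : Subset n) where

  private
    N : ℕ
    N = length (members (∁ S))

    G′ : Graph N
    G′ = induced G (∁ S)

    φ : Fin N → Fin n
    φ = lookup (members (∁ S))

    φ-injective : ∀ {u v} → φ u ≡ φ v → u ≡ v
    φ-injective = lookup-injective (unique-members (∁ S))

    φ∉members : ∀ v → φ v ∉ members S
    φ∉members v v∈ = x∈∁p⇒x∉p (∈-members⁻ (∁ S) (∈-lookup v)) (∈-members⁻ S v∈)

    members⊎φ : ∀ v → v ∈ members S ⊎ ∃[ w ] v ≡ φ w
    members⊎φ v with v ∈ˢ? S
    ... | yes v∈ = inj₁ (∈-members⁺ S v∈)
    ... | no v∉  = inj₂ (index p , lookup-index p)
      where p = ∈-members⁺ (∁ S) (x∉p⇒x∈∁p v∉)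

  order-induced : N + ∣ S ∣ ≡ n
  order-induced = trans (cong (_+ ∣ S ∣) (trans (length-members (∁ S)) (∣∁p∣≡n∸∣p∣ S))) (m∸n+n≡m (∣p∣≤n S))

  degree≤degree-induced : ∀ v → degree G (φ v) ≤ degree G′ v + ∣ S ∣
  degree≤degree-induced v = ≤-trans (unique-⊆⇒length≤ (filter⁺ (adj? G (φ v)) (allFin⁺ n)) sub)
    (≤-reflexive (trans (length-++ (map φ nb)) (cong₂ _+_ (length-map φ nb) (length-members S))))
    where
    nb : List (Fin N)
    nb = filter (adj? G′ v) (allFin N)
    sub : ∀ {w} → w ∈ filter (adj? G (φ v)) (allFin n) → w ∈ map φ nb ++ members S
    sub {w} w∈ with members⊎φ w
    ... | inj₁ w∈S = ∈-++⁺ʳ (map φ nb) w∈S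
    ... | inj₂ (w′ , refl) = ∈-++⁺ˡ (∈-map⁺ φ (∈-filter⁺ (adj? G′ v) (∈-allFin w′)
                               (proj₂ (∈-filter⁻ (adj? G (φ v)) {xs = allFin n} w∈))))

  few-induced : ∀ {k} c → ∣ S ∣ ≤ k → 6 * (suc c + k) ≤ n → e H[ n , k , suc c + k ] < e G →
                ∀ i → c < i → i + i < N → Few G′ i
  few-induced {k} c S≤k large eH<eG i c<i 2i<N T uT low = ≰⇒> λ i≤T →
    -- The edge count is made for exactly i vertices, so a longer T is cut down to i.
    few-lowDegree G k c i (map φ (take i T)) c<i
      (<-≤-trans 2i<N (≤-trans (m≤m+n N ∣ S ∣) (≤-reflexive order-induced))) large eH<eG
      (map⁺ φ-injective (take⁺ i uT))
      (trans (length-map φ (take i T)) (trans (length-take i T) (m≤n⇒m⊓n≡m i≤T)))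
      bound
    where
    bound : ∀ {v} → v ∈ map φ (take i T) → degree G v ≤ i + k
    bound v∈ with ∈-map⁻ φ v∈
    ... | w , w∈ , refl = ≤-trans (degree≤degree-induced w)
      (+-mono-≤ (All.lookup (Allₚ.take⁺ i (All.tabulate low)) w∈) S≤k)

  -- Moving S into X turns isolation inside `G − S` into isolation inside G. The joined clique then
  -- has k + c vertices, as in H, or k + 1, as in L.
  exceptional⇒⊑ : ∀ {k} c → 1 ≤ c → ∣ S ∣ ≡ k → 2 * (c + k) + c ≤ n → Exceptional G′ c → G ⊑ H[ n , k , c + k ] ⊎ G ⊑ L[ n , k , c + k ]
  exceptional⇒⊑ {k} c 1≤c S≡k large ex = byType isolation
    where
    open Exceptional ex
    X⁺ A⁺ : List (Fin n)
    X⁺ = members S ++ map φ X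
    A⁺ = map φ A
    uX⁺ : Unique X⁺
    uX⁺ = ++⁺ (unique-members S) (map⁺ φ-injective uniqueX) λ { (v∈S , v∈X) → notBoth v∈S (∈-map⁻ φ v∈X) }
      where
      notBoth : ∀ {v} → v ∈ members S → ¬ (∃[ w ] w ∈ X × v ≡ φ w)
      notBoth v∈S (w , _ , refl) = φ∉members w v∈S
    φ⁻ : ∀ {v xs} → φ v ∈ map φ xs → v ∈ xs
    φ⁻ {xs = xs} v∈ with ∈-map⁻ φ v∈
    ... | w , w∈ , eq = subst (_∈ xs) (sym (φ-injective eq)) w∈
    disj : ∀ {v} → v ∈ A⁺ → v ∉ X⁺
    disj v∈A v∈X⁺ with ∈-map⁻ φ v∈A
    ... | w , w∈ , refl with ∈-++⁻ (members S) v∈X⁺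
    ...   | inj₁ v∈S = φ∉members w v∈S
    ...   | inj₂ v∈X = disjoint w∈ (φ⁻ v∈X)
    sizeX⁺ : length X⁺ ≡ k + length X
    sizeX⁺ = trans (length-++ (members S)) (cong₂ _+_ (trans (length-members S) S≡k) (length-map φ X))
    sizeA⁺ : length A⁺ ≡ c + k ∸ k
    sizeA⁺ = trans (trans (length-map φ A) sizeA) (sym (m+n∸n≡m c k))
    nbrs⁺ : (∀ {u v} → u ∈ A → Adj G′ u v → v ∈ A ⊎ v ∈ X) → ∀ {u v} → u ∈ A⁺ → Adj G u v → v ∈ A⁺ ⊎ v ∈ X⁺
    nbrs⁺ nb {v = v} u∈ uv with ∈-map⁻ φ u∈ | members⊎φ v
    ... | _ | inj₁ v∈S = inj₂ (∈-++⁺ˡ v∈S)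
    ... | u′ , u′∈ , refl | inj₂ (v′ , refl) with nb u′∈ uv
    ...   | inj₁ v∈A = inj₁ (∈-map⁺ φ v∈A)
    ...   | inj₂ v∈X = inj₂ (∈-++⁺ʳ (members S) (∈-map⁺ φ v∈X))
    sizeH : (c + k) + (((n + k) ∸ 2 * (c + k)) + (c + k ∸ k)) ≡ n
    sizeH = +-cancelʳ-≡ k _ n (begin
      (c + k) + (z + (c + k ∸ k)) + k   ≡⟨ cong (λ y → (c + k) + (z + y) + k) (m+n∸n≡m c k) ⟩
      (c + k) + (z + c) + k             ≡⟨ solve 3 (λ c k z → (c :+ k) :+ (z :+ c) :+ k := con 2 :* (c :+ k) :+ z) refl c k z ⟩
      2 * (c + k) + z                   ≡⟨ m+[n∸m]≡n (≤-trans (m≤m+n _ c) (≤-trans large (m≤m+n n k))) ⟩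
      n + k                             ∎)
      where
      open ≡-Reasoning
      z = (n + k) ∸ 2 * (c + k)
    sizeL : (k + 1) + ((n ∸ (c + k) ∸ 1) + (c + k ∸ k)) ≡ n
    sizeL = begin
      (k + 1) + ((n ∸ (c + k) ∸ 1) + (c + k ∸ k))  ≡⟨ cong₂ (λ x y → (k + 1) + (x + y)) (∸-+-assoc n (c + k) 1) (m+n∸n≡m c k) ⟩
      (k + 1) + (z + c)                            ≡⟨ solve 3 (λ c k z → (k :+ con 1) :+ (z :+ c) := (c :+ k :+ con 1) :+ z) refl c k z ⟩
      (c + k + 1) + z                              ≡⟨ m+[n∸m]≡n c+k<n ⟩
      n                                            ∎
      where
      open ≡-Reasoning
      z = n ∸ (c + k + 1)
      c+k<n : c + k + 1 ≤ n
      c+k<n = ≤-trans (+-mono-≤ (m≤m+n (c + k) (c + k + 0)) 1≤c) large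
    independent : (∀ {u v} → u ∈ A → Adj G′ u v → v ∈ X) →
      ∀ {u v} → (∃[ u′ ] u′ ∈ A × u ≡ φ u′) → (∃[ v′ ] v′ ∈ A × v ≡ φ v′) → ¬ Adj G u v
    independent nb (_ , u∈ , refl) (_ , v∈ , refl) uv = disjoint v∈ (nb u∈ uv)
    byType : Isolation G′ A X c → G ⊑ H[ n , k , c + k ] ⊎ G ⊑ L[ n , k , c + k ]
    byType (inj₁ (∣X∣≡c , nb)) = inj₁ (embed (trans sizeX⁺ (trans (cong (k +_) ∣X∣≡c) (+-comm k c))) sizeA⁺ sizeH)
      where
      open Embedding G X⁺ A⁺ uX⁺ (map⁺ φ-injective uniqueA) disj I (nbrs⁺ (λ u∈ uv → inj₂ (nb u∈ uv)))
        (λ u∈ v∈ → independent nb (∈-map⁻ φ u∈) (∈-map⁻ φ v∈))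
    byType (inj₂ (∣X∣≡1 , nb)) = inj₂ (embed (trans sizeX⁺ (cong (k +_) ∣X∣≡1)) sizeA⁺ sizeL)
      where
      open Embedding G X⁺ A⁺ uX⁺ (map⁺ φ-injective uniqueA) disj K (nbrs⁺ nb)
        (λ u∈ v∈ uv eq → irrefl G _ (subst (Adj G _) (sym (trans (lookup-index u∈) (trans (cong (lookup A⁺) eq) (sym (lookup-index v∈))))) uv))

-- From the closure and the removed sets back to the given graph

degree-mono : ∀ {n} (G C : Graph n) → G ⊆ᴳ C → ∀ v → degree G v ≤ degree C v
degree-mono {n} G C sub v = unique-⊆⇒length≤ (filter⁺ (adj? G v) (allFin⁺ n)) λ {w} w∈ →
  ∈-filter⁺ (adj? C v) (∈-allFin w) (sub (proj₂ (∈-filter⁻ (adj? G v) {xs = allFin n} w∈)))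

Exceptional-⊆ᴳ : ∀ {n c} {G C : Graph n} → G ⊆ᴳ C → Exceptional C c → Exceptional G c
Exceptional-⊆ᴳ {c = c} {G} {C} sub ex = record
  { A = A ; X = X ; uniqueA = uniqueA ; uniqueX = uniqueX ; disjoint = disjoint ; sizeA = sizeA
  ; degrees = λ v∈ → ≤-trans (degree-mono G C sub _) (degrees v∈)
  ; isolation = restrict isolation }
  where
  open Exceptional ex
  restrict : Isolation C A X c → Isolation G A X c
  restrict (inj₁ (eq , nb)) = inj₁ (eq , λ u∈ uv → nb u∈ (sub uv))
  restrict (inj₂ (eq , nb)) = inj₂ (eq , λ u∈ uv → nb u∈ (sub uv))

-- One exceptional S settles the alternative for G as a whole. Searching the finitely many subsets
-- finds it without deciding Q.
∀⊎⇒∀⊎ : ∀ {n} {P : Subset n → Set} {Q : Set} → (∀ S → P S ⊎ Q) → (∀ S → P S) ⊎ Q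
∀⊎⇒∀⊎ {zero} f with f Vec.[]
... | inj₁ p = inj₁ λ { Vec.[] → p }
... | inj₂ q = inj₂ q
∀⊎⇒∀⊎ {suc n} f with ∀⊎⇒∀⊎ (f ∘ (inside Vec.∷_)) | ∀⊎⇒∀⊎ (f ∘ (outside Vec.∷_))
... | inj₁ p | inj₁ q = inj₁ λ { (inside Vec.∷ S) → p S ; (outside Vec.∷ S) → q S }
... | inj₂ q | _      = inj₂ q
... | inj₁ _ | inj₂ q = inj₂ q

minDegree≤degree : ∀ {n} (G : Graph n) v → minDegree G ≤ degree G v
minDegree≤degree {n} G v = All.lookup (min≤xs n (map (degree G) (allFin n))) (∈-map⁺ (degree G) (∈-allFin v))

module _ {n} (G : Graph n) (c : ℕ) (large : 2 * c + 3 ≤ n)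
  (c≤deg : ∀ v → c ≤ degree G v) (few : ∀ i → c < i → i + i < n → Few G i) where

  hamiltonian⊎exceptional : Hamiltonian G ⊎ Exceptional G c
  hamiltonian⊎exceptional with oreClosure (≤-trans (m≤n+m 3 (2 * c)) large) G
  ... | C , sub , closed , back
    with Closed.hamiltonCycle⊎exceptional C closed c large
           (λ v → ≤-trans (c≤deg v) (degree-mono G C sub v))
           (λ i c<i 2i<n T uT low → few i c<i 2i<n T uT λ v∈ → ≤-trans (degree-mono G C sub _) (low v∈))
  ... | inj₁ cyc = inj₁ (HamiltonCycle⇒Hamiltonian G (≤-trans (m≤n+m 3 (2 * c)) large) (back cyc))
  ... | inj₂ ex  = inj₂ (Exceptional-⊆ᴳ sub ex)

private
  2c+3+k≤ : ∀ c k → 2 * c + 3 + k ≤ 6 * (suc c + k)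
  2c+3+k≤ c k = subst (2 * c + 3 + k ≤_)
    (solve 2 (λ c k → con 2 :* c :+ con 3 :+ k :+ (con 4 :* c :+ con 5 :* k :+ con 3) := con 6 :* (con 1 :+ c :+ k)) refl c k)
    (m≤m+n _ _)

  2[c+k]+c≤ : ∀ c k → 2 * (c + k) + c ≤ 6 * (suc c + k)
  2[c+k]+c≤ c k = subst (2 * (c + k) + c ≤_)
    (solve 2 (λ c k → con 2 :* (c :+ k) :+ c :+ (con 3 :* c :+ con 4 :* k :+ con 6) := con 6 :* (con 1 :+ c :+ k)) refl c k)
    (m≤m+n _ _)

kHamiltonian⊎⊑ : ∀ k c → 1 ≤ c → ∀ n → 6 * (suc c + k) ≤ n → (G : Graph n) → c + k ≤ minDegree G →
  e H[ n , k , suc c + k ] < e G → (k -Hamiltonian) G ⊎ G ⊑ H[ n , k , c + k ] ⊎ G ⊑ L[ n , k , c + k ]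
kHamiltonian⊎⊑ k c 1≤c n large G δ≤ eH<eG = ∀⊎⇒∀⊎ bySet
  where
  module _ (S : Subset n) (S≤k : ∣ S ∣ ≤ k) where

    N : ℕ
    N = length (members (∁ S))

    G′ : Graph N
    G′ = induced G (∁ S)

    c+k≤ : ∀ v → c + k ≤ degree G′ v + ∣ S ∣
    c+k≤ v = ≤-trans (≤-trans δ≤ (minDegree≤degree G (lookup (members (∁ S)) v))) (degree≤degree-induced G S v)

    c≤ : ∀ v → c ≤ degree G′ v
    c≤ v = +-cancelʳ-≤ k c _ (≤-trans (c+k≤ v) (+-monoʳ-≤ _ S≤k))

    largeN : 2 * c + 3 ≤ N
    largeN = +-cancelʳ-≤ k _ N (≤-trans (2c+3+k≤ c k) (≤-trans large (≤-trans (≤-reflexive (sym (order-induced G S))) (+-monoʳ-≤ N S≤k))))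

    exceptional⇒ : Exceptional G′ c → G ⊑ H[ n , k , c + k ] ⊎ G ⊑ L[ n , k , c + k ]
    exceptional⇒ ex = exceptional⇒⊑ G S c 1≤c (≤-antisym S≤k (k≤ A refl)) (≤-trans (2[c+k]+c≤ c k) large) ex
      where
      open Exceptional ex
      k≤ : ∀ A′ → A′ ≡ A → k ≤ ∣ S ∣
      k≤ [] A≡ = contradiction (subst (1 ≤_) (trans (sym sizeA) (cong length (sym A≡))) 1≤c) λ ()
      -- In G the vertex v has degree at least c + k, and at most c after the removal of S, so S has
      -- at least k elements.
      k≤ (v ∷ _) A≡ = +-cancelˡ-≤ c k _ (≤-trans (c+k≤ v) (+-monoˡ-≤ ∣ S ∣ (degrees (subst (v ∈_) A≡ (here refl)))))

  bySet : ∀ S → (∣ S ∣ ≤ k → Hamiltonian (induced G (∁ S))) ⊎ (G ⊑ H[ n , k , c + k ] ⊎ G ⊑ L[ n , k , c + k ])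
  bySet S = byBound (∣ S ∣ ≤? k)
    where
    byBound : Dec (∣ S ∣ ≤ k) → _
    byBound (no S≰k)  = inj₁ λ S≤k → contradiction S≤k S≰k
    byBound (yes S≤k) = Sum.map (λ ham _ → ham) (exceptional⇒ S S≤k)
      (hamiltonian⊎exceptional (G′ S S≤k) c (largeN S S≤k) (c≤ S S≤k) (few-induced G S c S≤k large eH<eG))

theorem3p6 : ∀ (k δ : ℕ) → k < δ →
    ∃[ n₀ ] (∀ (n : ℕ) → n₀ ≤ n → (G : Graph n) →
    δ ≤ minDegree G →
    e H[ n , k , δ + 1 ] < e G →
    (k -Hamiltonian) G ⊎ G ⊑ H[ n , k , δ ] ⊎ G ⊑ L[ n , k , δ ])
theorem3p6 k δ k<δ = 6 * (suc c + k) , λ n large G δ≤ eH<eG →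
  subst (λ d → (k -Hamiltonian) G ⊎ G ⊑ H[ n , k , d ] ⊎ G ⊑ L[ n , k , d ]) c+k≡δ
    (kHamiltonian⊎⊑ k c (m<n⇒0<n∸m k<δ) n large G (subst (_≤ minDegree G) (sym c+k≡δ) δ≤)
      (subst (λ d → e H[ n , k , d ] < e G) (trans (+-comm δ 1) (cong suc (sym c+k≡δ))) eH<eG))
  where
  c : ℕ
  -- The minimum degree guaranteed after removing k vertices, positive as k < δ. The threshold is
  -- thus 6(δ + 1).
  c = δ ∸ k
  c+k≡δ : c + k ≡ δ
  c+k≡δ = m∸n+n≡m (<⇒≤ k<δ)
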